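{- Let $Q$ be an $(n,q)$-cactus with $q\ge 2$. The following are equivalent: (i) $\overrightarrow{rvc}(Q)=n-2$; (ii) $\overrightarrow{trc}(Q)=2n-3$; (iii) $B(Q)$ is the path $P_q$ and $Q[K_Q]$ is the directed path $\overrightarrow{P}_{q-1}$ on $q-1$ vertices.
   Context: A cactus is a strongly connected oriented graph (finite, no loops, no multiple arcs, no pair of opposite arcs) in which every arc belongs to exactly one directed cycle; its blocks (maximal subdigraphs without a cut-vertex) are directed cycles. An $(n,q)$-cactus has $n$ vertices and $q$ blocks. $K_Q$ is the set of cut-vertices of $Q$ and $Q[K_Q]$ the subdigraph induced by it. The block graph $B(Q)$ has the blocks of $Q$ as vertices, two blocks adjacent iff they share a vertex. $P_q$ is the undirected path on $q$ vertices; $\overrightarrow{P}_{q-1}$ is the directed path on $q-1$ vertices. $\overrightarrow{rvc}(D)$ is the minimum number of colours in a vertex-colouring such that every ordered pair $(x,y)$ is joined by a directed path whose internal vertices have distinct colours. $\overrightarrow{trc}(D)$ is the minimum number of colours in a total-colouring (of vertices and arcs) such that every ordered pair is joined by a directed path whose arcs and internal vertices all receive pairwise distinct colours. -}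

module Defs where

open import Data.Nat using (ℕ; zero; suc; _<_)
open import Data.Fin using (Fin; toℕ)
open import Data.Fin.Subset using (Subset; _∈_; _⊆_; _-_; ⊤; Nonempty)
open import Data.Bool using (Bool; true; false; T; _∧_; _∨_)
open import Data.Vec using (lookup)
open import Data.List using (List; []; _∷_; _++_; map)
open import Data.List.Relation.Unary.Unique.Propositional using (Unique)
open import Data.List.Membership.Propositional using () renaming (_∈_ to _∈ₗ_)
open import Data.Product using (Σ; ∃; ∃-syntax; _×_; _,_; proj₁; proj₂)
open import Data.Sum using (_⊎_)
open import Relation.Binary.PropositionalEquality using (_≡_; _≢_)
open import Relation.Nullary using (¬_)
open import Function.Bundles using (_⇔_)
open import Function.Definitions using (Injective)

Digraph : ℕ → Set
Digraph n = Fin n → Fin n → Bool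

module _ {n : ℕ} (A : Digraph n) where

  data Walk : Fin n → Fin n → Set where
    stop : (x : Fin n) → Walk x x
    step : (x : Fin n) {y z : Fin n} → T (A x y) → Walk y z → Walk x z

module _ {n : ℕ} {A : Digraph n} where

  verts : ∀ {x y} → Walk A x y → List (Fin n)
  verts (stop x) = x ∷ []
  verts (step x _ w) = x ∷ verts w

  initVerts : ∀ {x y} → Walk A x y → List (Fin n)
  initVerts (stop _) = []
  initVerts (step x _ w) = x ∷ initVerts w

  internal : ∀ {x y} → Walk A x y → List (Fin n)
  internal (stop _) = []
  internal (step _ _ w) = initVerts w

  arcs : ∀ {x y} → Walk A x y → List (Fin n × Fin n)
  arcs (stop _) = []
  arcs (step x {y} _ w) = (x , y) ∷ arcs w

IsPath : ∀ {n} {A : Digraph n} {x y} → Walk A x y → Set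
IsPath w = Unique (verts w)

Oriented : ∀ {n} → Digraph n → Set
Oriented {n} A = (∀ (x : Fin n) → A x x ≡ false)
               × (∀ (x y : Fin n) → T (A x y) → A y x ≡ false)

StronglyConnected : ∀ {n} → Digraph n → Set
StronglyConnected {n} A = ∀ (x y : Fin n) → Σ (Walk A x y) IsPath

record DiCycle {n : ℕ} (A : Digraph n) : Set where
  constructor cycle
  field
    start end : Fin n
    path      : Walk A start end
    isPath    : IsPath path
    closing   : T (A end start)

cycleArcs : ∀ {n} {A : Digraph n} → DiCycle A → List (Fin n × Fin n)
cycleArcs (cycle s e p _ _) = arcs p ++ ((e , s) ∷ [])

SameCycle : ∀ {n} {A : Digraph n} → DiCycle A → DiCycle A → Set
SameCycle {n} C C' = ∀ (a : Fin n × Fin n) → (a ∈ₗ cycleArcs C) ⇔ (a ∈ₗ cycleArcs C')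

Cactus : ∀ {n} → Digraph n → Set
Cactus {n} A =
  Oriented A × StronglyConnected A ×
  (∀ (u v : Fin n) → T (A u v) →
     Σ (DiCycle A) λ C → ((u , v) ∈ₗ cycleArcs C) ×
       (∀ (C' : DiCycle A) → (u , v) ∈ₗ cycleArcs C' → SameCycle C C'))

underlyingOn : ∀ {n} → Digraph n → Subset n → Digraph n
underlyingOn A S x y = lookup S x ∧ lookup S y ∧ (A x y ∨ A y x)

-- the subgraph induced by S is connected (the empty graph counts as connected)
ConnectedOn : ∀ {n} → Digraph n → Subset n → Set
ConnectedOn {n} A S = ∀ (x y : Fin n) → x ∈ S → y ∈ S → Walk (underlyingOn A S) x y

IsCutVertex : ∀ {n} → Digraph n → Fin n → Set
IsCutVertex A v = ¬ ConnectedOn A (⊤ - v)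

Nonseparable : ∀ {n} → Digraph n → Subset n → Set
Nonseparable {n} A S = Nonempty S × ConnectedOn A S ×
                       (∀ (v : Fin n) → v ∈ S → ConnectedOn A (S - v))

-- a block: (the vertex set of) a maximal subdigraph without a cut-vertex
-- (maximal such subdigraphs are induced, so vertex sets suffice)
IsBlock : ∀ {n} → Digraph n → Subset n → Set
IsBlock {n} A S = Nonseparable A S ×
                  (∀ (S' : Subset n) → Nonseparable A S' → S ⊆ S' → S' ≡ S)

BlockEnum : ∀ {n} → Digraph n → (q : ℕ) → (Fin q → Subset n) → Set
BlockEnum {n} A q β = Injective _≡_ _≡_ β × (∀ i → IsBlock A (β i)) ×
                      (∀ (S : Subset n) → IsBlock A S → ∃[ i ] β i ≡ S)

HasBlocks : ∀ {n} → Digraph n → ℕ → Set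
HasBlocks A q = ∃[ β ] BlockEnum A q β

IsCactus : (n q : ℕ) → Digraph n → Set
IsCactus n q A = Cactus A × HasBlocks A q

BlockGraphIsPath : ∀ {n} → Digraph n → (q : ℕ) → Set
BlockGraphIsPath {n} A q =
  ∃[ β ] BlockEnum A q β ×
    (∀ (i j : Fin q) → i ≢ j →
       (∃[ v ] (v ∈ β i × v ∈ β j)) ⇔ (suc (toℕ i) ≡ toℕ j ⊎ suc (toℕ j) ≡ toℕ i))

CutVerticesDiPath : ∀ {n} → Digraph n → (m : ℕ) → Set
CutVerticesDiPath {n} A m =
  ∃ λ (c : Fin m → Fin n) → (Injective _≡_ _≡_ c ×
          (∀ (v : Fin n) → IsCutVertex A v ⇔ (∃[ i ] c i ≡ v)) ×
          (∀ (i j : Fin m) → T (A (c i) (c j)) ⇔ (toℕ j ≡ suc (toℕ i))))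

RVColouring : ∀ {n} → Digraph n → ℕ → Set
RVColouring {n} A k =
  Σ (Fin n → Fin k) λ c →
    ∀ (x y : Fin n) → x ≢ y →
      Σ (Walk A x y) λ w → IsPath w × Unique (map c (internal w))

RVC≡ : ∀ {n} → Digraph n → ℕ → Set
RVC≡ A k = RVColouring A k × (∀ k' → k' < k → ¬ RVColouring A k')

TRColouring : ∀ {n} → Digraph n → ℕ → Set
TRColouring {n} A k =
  Σ (Fin n → Fin k) λ cv → Σ (Fin n → Fin n → Fin k) λ ca →
    ∀ (x y : Fin n) → x ≢ y →
      Σ (Walk A x y) λ w → IsPath w ×
        Unique (map (λ a → ca (proj₁ a) (proj₂ a)) (arcs w)
                ++ map cv (internal w))

TRC≡ : ∀ {n} → Digraph n → ℕ → Set
TRC≡ A k = TRColouring A k × (∀ k' → k' < k → ¬ TRColouring A k')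

{-# OPTIONS --safe #-}
-- In a cactus every ordered pair of vertices is joined by a unique directed path, so a colouring is
-- constrained by these routes only.  All three conditions are equivalent to the existence of a
-- Hamiltonian directed path.
--
-- A leaf is a cycle k → s ⇝ p → k on which only k has further out-arcs.  A route that enters s ends
-- in its leaf and a route that leaves p starts in its leaf, so for two disjoint leaves the vertices
-- s, s′ may share a colour, the vertices p, p′ may share a colour, and so may the arcs into s, s′
-- when arcs are coloured by their heads.  This gives n - 2 vertex colours and n - 1 arc colours, and
-- along a Hamiltonian path neither can be improved.  If the route from s to p′ is not Hamiltonian,
-- then the out-tree of s has an end a ≠ p′, and a may share the colour of p.  When both routes s ⇝ p′
-- and s′ ⇝ p miss a vertex, one vertex colour is saved.
--
-- Deleting v separates exactly those vertices whose routes from v start with different arcs.  Hence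
-- blocks are cycles and cut-vertices are the vertices of out-degree at least two.
module Submission where

open import Defs
open import Data.Bool using (T; false)
open import Data.Bool.Properties using (T-irrelevant; T?; T-∧; T-∨; T-≡)
open import Data.Empty using (⊥; ⊥-elim)
open import Data.Fin using (Fin; zero; suc; _≟_; toℕ; fromℕ; fromℕ<; punchOut; splitAt; _↑ˡ_; _↑ʳ_)
open import Data.Fin.Properties
  using (any?; punchOut-injective; injective⇒≤; ↑ˡ-injective; ↑ʳ-injective; splitAt-↑ˡ; splitAt-↑ʳ; suc-injective;
         toℕ-injective; toℕ<n; toℕ-fromℕ; toℕ-fromℕ<; fromℕ<-toℕ)
open import Data.Fin.Subset using (Subset; _∈_; _∉_; _⊆_; _⊂_; _-_; ⊤)
open import Data.Fin.Subset.Induction using (⊂-wellFounded; Acc; acc)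
open import Data.Fin.Subset.Properties using (x∈p∧x≢y⇒x∈p-y; p─q⊆p; ⊆-antisym; ∈⊤; _∈?_)
open import Data.List using (List; _∷_; []; _++_; map; length; lookup)
open import Data.List.Membership.Propositional using (lose) renaming (_∈_ to _∈ₗ_; _∉_ to _∉ₗ_)
open import Data.List.Membership.Propositional.Properties using (∈-++⁻; ∈-++⁺ʳ; ∈-map⁻; ∈-lookup)
open import Data.List.Properties using (map-∘; length-map; length-++)
open import Data.List.Relation.Unary.All as All using ([]; _∷_)
open import Data.List.Relation.Unary.AllPairs using ([]; _∷_)
open import Data.List.Relation.Unary.Any using (Any; here; there; index) renaming (any? to anyₗ?)
open import Data.List.Relation.Unary.Any.Properties using (lookup-index)
open import Data.List.Relation.Unary.Unique.Propositional using (Unique)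
open import Data.List.Relation.Unary.Unique.Propositional.Properties using (++⁺) renaming (map⁺ to Unique-map⁺)
open import Data.Nat using (ℕ; zero; suc; pred; _+_; _*_; _∸_; _≤_; _<_; s≤s; _<?_; z<s) renaming (_≟_ to _≟ℕ_)
open import Data.Nat.Properties
  using (≤-refl; ≤-reflexive; ≤-trans; ≤-antisym; <-trans; ≤-<-trans; <-cmp; <⇒≢; <⇒≤; <⇒≱; ≮⇒≥; ≤∧≢⇒<; m≤n⇒m<n∨m≡n;
         n≤1+n; n<1+n; m≤m+n; m≤n+m; m<m+n; +-comm; +-suc; +-identityʳ; +-monoˡ-≤; *-monoʳ-≤; +-∸-assoc; m+[n∸m]≡n;
         m∸n≤m; m∸[m∸n]≡n; m<n⇒0<n∸m; ∸-monoˡ-≤; ∸-monoʳ-<; ∸-cancelˡ-≡)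
  renaming (suc-injective to ℕ-suc-injective)
open import Data.Product using (Σ; ∃; ∃-syntax; _×_; _,_; proj₁; proj₂)
open import Data.Product.Properties using (,-injectiveˡ; ,-injectiveʳ)
open import Data.Sum using (_⊎_; inj₁; inj₂; swap)
open import Data.Vec using (_∷_; there; tabulate) renaming (lookup to lookupᵥ)
open import Data.Vec.Properties using (lookup⇒[]=; []=⇒lookup; lookup∘tabulate)
open import Function using (_∘_; case_of_)
open import Function.Bundles using (_⇔_; Equivalence; mk⇔)
open import Function.Definitions using (Injective)
open import Relation.Binary.Definitions using (tri<; tri≈; tri>)
open import Relation.Binary.PropositionalEquality
open import Relation.Nullary using (¬_; ¬?; Dec; yes; no; does; contradiction)
open import Relation.Nullary.Decidable using (_×-dec_; decidable-stable; dec-true)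

-- Walks and paths in a digraph

module _ {n} {A : Digraph n} where
  open import Data.List.Membership.DecPropositional (_≟_ {n}) using () renaming (_∈?_ to _∈ₗ?_)

  infixr 5 _⊕_
  _⊕_ : ∀ {x y z} → Walk A x y → Walk A y z → Walk A x z
  stop _     ⊕ w = w
  step x e v ⊕ w = step x e (v ⊕ w)

  initVerts-⊕ : ∀ {x y z} (v : Walk A x y) (w : Walk A y z) →
                initVerts (v ⊕ w) ≡ initVerts v ++ initVerts w
  initVerts-⊕ (stop _)     w = refl
  initVerts-⊕ (step x e v) w = cong (x ∷_) (initVerts-⊕ v w)

  start∈ : ∀ {x y} (w : Walk A x y) → x ∈ₗ verts w
  start∈ (stop _)     = here refl
  start∈ (step _ _ _) = here refl

  end∈ : ∀ {x y} (w : Walk A x y) → y ∈ₗ verts w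
  end∈ (stop _)     = here refl
  end∈ (step _ _ w) = there (end∈ w)

  ∈-⊕⁻ : ∀ {x y z u} (v : Walk A x y) (w : Walk A y z) →
         u ∈ₗ verts (v ⊕ w) → u ∈ₗ verts v ⊎ u ∈ₗ verts w
  ∈-⊕⁻ (stop _)     w u∈         = inj₂ u∈
  ∈-⊕⁻ (step x e v) w (here eq)  = inj₁ (here eq)
  ∈-⊕⁻ (step x e v) w (there u∈) with ∈-⊕⁻ v w u∈
  ... | inj₁ p = inj₁ (there p)
  ... | inj₂ p = inj₂ p

  ∈-⊕ˡ : ∀ {x y z u} (v : Walk A x y) (w : Walk A y z) → u ∈ₗ verts v → u ∈ₗ verts (v ⊕ w)
  ∈-⊕ˡ (stop _)     w (here refl) = start∈ w
  ∈-⊕ˡ (step x e v) w (here eq)   = here eq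
  ∈-⊕ˡ (step x e v) w (there u∈)  = there (∈-⊕ˡ v w u∈)

  ∈-⊕ʳ : ∀ {x y z u} (v : Walk A x y) (w : Walk A y z) → u ∈ₗ verts w → u ∈ₗ verts (v ⊕ w)
  ∈-⊕ʳ (stop _)     w u∈ = u∈
  ∈-⊕ʳ (step x e v) w u∈ = there (∈-⊕ʳ v w u∈)

  split : ∀ {x y z} (w : Walk A x y) → z ∈ₗ verts w →
          Σ (Walk A x z) λ u → Σ (Walk A z y) λ v → w ≡ u ⊕ v
  split (stop x)     (here refl) = stop x , stop x , refl
  split (step x e w) (here refl) = stop x , step x e w , refl
  split (step x e w) (there z∈)  with split w z∈
  ... | u , v , refl = step x e u , v , refl

  step-path : ∀ {x y z} (e : T (A x y)) (w : Walk A y z) →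
              x ∉ₗ verts w → IsPath w → IsPath (step x e w)
  step-path e w x∉ p = All.tabulate (λ {z} z∈ x≡z → x∉ (subst (_∈ₗ _) (sym x≡z) z∈)) ∷ p

  step-path⁻ : ∀ {x y z} (e : T (A x y)) (w : Walk A y z) →
               IsPath (step x e w) → x ∉ₗ verts w × IsPath w
  step-path⁻ e w (x# ∷ p) = (λ x∈ → All.lookup x# x∈ refl) , p

  ⊕-path : ∀ {x y z} (v : Walk A x y) (w : Walk A y z) → IsPath v → IsPath w →
           (∀ u → u ∈ₗ verts v → u ∈ₗ verts w → u ≡ y) → IsPath (v ⊕ w)
  ⊕-path (stop _)         w pv pw meet = pw
  ⊕-path {y = y} (step x e v) w pv pw meet =
    let x∉v , pv′ = step-path⁻ e v pv in
    step-path e (v ⊕ w)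
      (λ x∈ → case ∈-⊕⁻ v w x∈ of λ where
        (inj₁ x∈v) → x∉v x∈v
        (inj₂ x∈w) → x∉v (subst (_∈ₗ verts v) (sym (meet x (here refl) x∈w)) (end∈ v)))
      (⊕-path v w pv′ pw (λ u u∈v → meet u (there u∈v)))

  ⊕-path⁻ : ∀ {x y z} (v : Walk A x y) (w : Walk A y z) → IsPath (v ⊕ w) →
            IsPath v × IsPath w × (∀ u → u ∈ₗ verts v → u ∈ₗ verts w → u ≡ y)
  ⊕-path⁻ (stop _)     w p = [] ∷ [] , p , λ { u (here eq) _ → eq }
  ⊕-path⁻ (step x e v) w p =
    let x∉ , p′ = step-path⁻ e (v ⊕ w) p
        pv , pw , meet = ⊕-path⁻ v w p′
    in step-path e v (x∉ ∘ ∈-⊕ˡ v w) pv , pw , λ where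
         u (here refl) u∈w → contradiction (∈-⊕ʳ v w u∈w) x∉
         u (there u∈v) u∈w → meet u u∈v u∈w

  shortcut : ∀ {x y} (w : Walk A x y) →
             Σ (Walk A x y) λ p → IsPath p × (∀ {u} → u ∈ₗ verts p → u ∈ₗ verts w)
  shortcut (stop x) = stop x , [] ∷ [] , λ u∈ → u∈
  shortcut (step x e w) with shortcut w
  ... | p , isP , p⊆w with x ∈ₗ? verts p
  ...   | no x∉ = step x e p , step-path e p x∉ isP , λ where
            (here eq)  → here eq
            (there u∈) → there (p⊆w u∈)
  ...   | yes x∈ with split p x∈
  ...     | u , v , refl = v , proj₁ (proj₂ (⊕-path⁻ u v isP)) , there ∘ p⊆w ∘ ∈-⊕ʳ u v

  last-arc : ∀ {x y z} (e : T (A x y)) (w : Walk A y z) →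
             ∃ λ p → Σ (Walk A x p) λ v → Σ (T (A p z)) λ e′ → step x e w ≡ v ⊕ step p e′ (stop z)
  last-arc e (stop _) = _ , stop _ , e , refl
  last-arc e (step _ e₁ w) with last-arc e₁ w
  ... | p , v , e₂ , eq = p , step _ e v , e₂ , cong (step _ e) eq

  arc-tail∈ : ∀ {x y u v} (w : Walk A x y) → (u , v) ∈ₗ arcs w → u ∈ₗ verts w
  arc-tail∈ (step x e w) (here refl) = here refl
  arc-tail∈ (step x e w) (there a∈)  = there (arc-tail∈ w a∈)

  -- The arc along which the walk leaves P for the last time.
  exit-arc : ∀ {P : Fin n → Set} (P? : ∀ v → Dec (P v)) {x y} (w : Walk A x y) → Any P (verts w) → ¬ P y →
             ∃[ u ] ∃[ v ] T (A u v) × P u × u ∈ₗ verts w ×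
               Σ (Walk A v y) λ w′ → ∀ {z} → z ∈ₗ verts w′ → ¬ P z
  exit-arc P? (stop x)     (here px) ¬px = contradiction px ¬px
  exit-arc P? (step x {z} e w) any ¬py with anyₗ? P? (verts w)
  ... | yes any′ with exit-arc P? w any′ ¬py
  ...   | u , v , a , pu , u∈ , rest = u , v , a , pu , there u∈ , rest
  exit-arc P? (step x {z} e w) (here px)  ¬py | no ¬any = x , z , e , px , here refl , w , λ z∈ pz → ¬any (lose z∈ pz)
  exit-arc P? (step x {z} e w) (there px) ¬py | no ¬any = contradiction px ¬any

-- Routes in a cactus and their first arcs

T-absurd : ∀ {b} → T b → ¬ b ≡ false
T-absurd t refl = t

module Routes {n} (A : Digraph n) (cactus : Cactus A) where
  open import Data.List.Membership.DecPropositional (_≟_ {n}) using () renaming (_∈?_ to _∈ₗ?_)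

  no-loop : ∀ {x} → ¬ T (A x x)
  no-loop t = T-absurd t (proj₁ (proj₁ cactus) _)

  arc-≢ : ∀ {x y} → T (A x y) → x ≢ y
  arc-≢ t refl = no-loop t

  no-digon : ∀ {x y} → T (A x y) → ¬ T (A y x)
  no-digon t t′ = T-absurd t′ (proj₂ (proj₁ cactus) _ _ t)

  -- The route from `v` to `u` ends with some arc z → u. Continuing `p` and `q` along it gives two
  -- directed cycles through z → u, which have the same arcs in a cactus. So u → b lies on the cycle
  -- that leaves `u` by u → a, and a cycle leaves `u` only once.
  same-first-arc : ∀ {u a b v} → T (A u a) → (p : Walk A a v) → u ∉ₗ verts p →
                   T (A u b) → (q : Walk A b v) → u ∉ₗ verts q → u ≢ v → a ≡ b
  same-first-arc {u} {a} {b} {v} ea p u∉p eb q u∉q u≢v with proj₁ (proj₂ cactus) v u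
  ... | stop _ , _ = contradiction refl u≢v
  ... | step _ e r , isR with last-arc e r
  ...   | z , r′ , ez , eqR = heads (same (u , b) (here refl))
    where
    u∉r′ : u ∉ₗ verts r′
    u∉r′ u∈ = no-loop (subst (λ t → T (A t u))
      (sym (proj₂ (proj₂ (⊕-path⁻ r′ _ (subst IsPath eqR isR))) u u∈ (there (here refl)))) ez)
    through : ∀ {c} → T (A u c) → (w : Walk A c v) → u ∉ₗ verts w →
              Σ (Walk A c z) λ w′ → IsPath w′ × u ∉ₗ verts w′
    through ec w u∉w with shortcut (w ⊕ r′)
    ... | w′ , isP , w′⊆ = w′ , isP , λ u∈ → case ∈-⊕⁻ w r′ (w′⊆ u∈) of λ where
      (inj₁ u∈w) → u∉w u∈w
      (inj₂ u∈r) → u∉r′ u∈r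
    p′ = through ea p u∉p
    q′ = through eb q u∉q
    toCycle : ∀ {c} → T (A u c) → (Σ (Walk A c z) λ w′ → IsPath w′ × u ∉ₗ verts w′) → DiCycle A
    toCycle ec (w , isP , u∉) = cycle u z (step u ec w) (step-path ec w u∉ isP) ez
    closing∈ : ∀ {c} (ec : T (A u c)) w → (z , u) ∈ₗ cycleArcs (toCycle ec w)
    closing∈ ec (w , _) = ∈-++⁺ʳ (arcs (step u ec w)) (here refl)
    same : ∀ a → a ∈ₗ cycleArcs (toCycle eb q′) → a ∈ₗ cycleArcs (toCycle ea p′)
    same a with _ , _ , all-same ← proj₂ (proj₂ cactus) z u ez =
      Equivalence.to (all-same (toCycle ea p′) (closing∈ ea p′) a) ∘
      Equivalence.from (all-same (toCycle eb q′) (closing∈ eb q′) a)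
    heads : (u , b) ∈ₗ cycleArcs (toCycle ea p′) → a ≡ b
    heads (here eq) = sym (,-injectiveʳ eq)
    heads (there m) with ∈-++⁻ (arcs (proj₁ p′)) m
    ... | inj₁ m′ = contradiction (arc-tail∈ (proj₁ p′) m′) (proj₂ (proj₂ p′))
    ... | inj₂ (here eq) = contradiction (subst (λ t → T (A t u)) (sym (,-injectiveˡ eq)) ez) no-loop

  path-unique : ∀ {x y} (v w : Walk A x y) → IsPath v → IsPath w → v ≡ w
  path-unique (stop _) (stop _) _ _ = refl
  path-unique (stop _) (step _ e w) _ pw = contradiction (end∈ w) (proj₁ (step-path⁻ e w pw))
  path-unique (step _ e v) (stop _) pv _ = contradiction (end∈ v) (proj₁ (step-path⁻ e v pv))
  path-unique (step x e v) (step _ f w) pv pw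
    with x∉v , pv′ ← step-path⁻ e v pv | x∉w , pw′ ← step-path⁻ f w pw
    with refl ← same-first-arc e v x∉v f w x∉w (λ { refl → x∉v (end∈ v) })
    = cong₂ (step x) (T-irrelevant e f) (path-unique v w pv′ pw′)

  abstract
    route : ∀ x y → Walk A x y
    route x y = proj₁ (proj₁ (proj₂ cactus) x y)

    route-path : ∀ x y → IsPath (route x y)
    route-path x y = proj₂ (proj₁ (proj₂ cactus) x y)

  route-unique : ∀ {x y} (w : Walk A x y) → IsPath w → route x y ≡ w
  route-unique w p = path-unique _ w (route-path _ _) p

  infix 4 _⟨_⟩_
  _⟨_⟩_ : Fin n → Fin n → Fin n → Set
  x ⟨ z ⟩ y = z ∈ₗ verts (route x y)

  on? : ∀ x z y → Dec (x ⟨ z ⟩ y)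
  on? x z y = z ∈ₗ? verts (route x y)

  -- Every walk shortcuts to the unique path, so no walk can bypass a vertex of the route.
  on-walk : ∀ {x y z} → x ⟨ z ⟩ y → (w : Walk A x y) → z ∈ₗ verts w
  on-walk z∈ w with p , isP , p⊆w ← shortcut w =
    p⊆w (subst (λ r → _ ∈ₗ verts r) (route-unique p isP) z∈)

  on-start : ∀ {x y} → x ⟨ x ⟩ y
  on-start {x} {y} = start∈ (route x y)

  on-end : ∀ {x y} → x ⟨ y ⟩ y
  on-end {x} {y} = end∈ (route x y)

  route-split : ∀ {x y z} → x ⟨ z ⟩ y → route x y ≡ route x z ⊕ route z y
  route-split {x} {y} z∈ with u , v , eq ← split (route x y) z∈
    with pu , pv , _ ← ⊕-path⁻ u v (subst IsPath eq (route-path x y)) =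
    trans eq (sym (cong₂ _⊕_ (route-unique u pu) (route-unique v pv)))

  on-left : ∀ {x y z u} → x ⟨ z ⟩ y → x ⟨ u ⟩ z → x ⟨ u ⟩ y
  on-left z∈ u∈ = subst (λ r → _ ∈ₗ verts r) (sym (route-split z∈)) (∈-⊕ˡ (route _ _) (route _ _) u∈)

  on-right : ∀ {x y z u} → x ⟨ z ⟩ y → z ⟨ u ⟩ y → x ⟨ u ⟩ y
  on-right z∈ u∈ = subst (λ r → _ ∈ₗ verts r) (sym (route-split z∈)) (∈-⊕ʳ (route _ _) (route _ _) u∈)

  meet : ∀ {x y z u} → x ⟨ z ⟩ y → x ⟨ u ⟩ z → z ⟨ u ⟩ y → u ≡ z
  meet {x} {y} {z} z∈ u∈ u∈′ =
    proj₂ (proj₂ (⊕-path⁻ (route x z) (route z y) (subst IsPath (route-split z∈) (route-path x y)))) _ u∈ u∈′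

  -- The detour through `u` is a walk too and cannot bypass `z`.
  via : ∀ {x y z} → x ⟨ z ⟩ y → ∀ u → x ⟨ z ⟩ u ⊎ u ⟨ z ⟩ y
  via z∈ u = ∈-⊕⁻ (route _ u) (route u _) (on-walk z∈ (route _ u ⊕ route u _))

  on-arc : ∀ {x y z} → T (A x y) → x ⟨ z ⟩ y → z ≡ x ⊎ z ≡ y
  on-arc e z∈ with on-walk z∈ (step _ e (stop _))
  ... | here eq = inj₁ eq
  ... | there (here eq) = inj₂ eq

  on-refl : ∀ {x z} → x ⟨ z ⟩ x → z ≡ x
  on-refl z∈ with on-walk z∈ (stop _)
  ... | here eq = eq

  join : ∀ {x y z} → (∀ u → x ⟨ u ⟩ z → z ⟨ u ⟩ y → u ≡ z) → x ⟨ z ⟩ y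
  join {x} {y} {z} disj = subst (λ r → z ∈ₗ verts r)
    (sym (route-unique _ (⊕-path (route x z) (route z y) (route-path x z) (route-path z y) disj)))
    (∈-⊕ˡ (route x z) (route z y) on-end)

  nested : ∀ {x y u v} → x ⟨ u ⟩ y → u ⟨ v ⟩ y → x ⟨ u ⟩ v
  nested u∈ v∈ = join λ w w∈ w∈′ → meet u∈ w∈ (on-left v∈ w∈′)

  -- First v b u: the route from v to u starts with the arc v → b.
  First : Fin n → Fin n → Fin n → Set
  First v b u = T (A v b) × ¬ b ⟨ v ⟩ u

  first? : ∀ v b u → Dec (First v b u)
  first? v b u = T? (A v b) ×-dec ¬? (on? b v u)

  first-≢ : ∀ {v b u} → First v b u → v ≢ u
  first-≢ (_ , v∉) refl = v∉ on-end

  first-route : ∀ {v b u} (f : First v b u) → route v u ≡ step v (proj₁ f) (route b u)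
  first-route (e , v∉) = route-unique _ (step-path e (route _ _) v∉ (route-path _ _))

  first-exists : ∀ {v u} → v ≢ u → ∃[ b ] First v b u
  first-exists {v} {u} v≢u with route v u | route-path v u
  ... | stop _     | _ = contradiction refl v≢u
  ... | step _ {b} e w | p with v∉ , pw ← step-path⁻ e w p =
    b , e , λ v∈ → v∉ (on-walk v∈ w)

  first-unique : ∀ {v b c u} → First v b u → First v c u → b ≡ c
  first-unique f@(e , v∉) (e′ , v∉′) = same-first-arc e (route _ _) v∉ e′ (route _ _) v∉′ (first-≢ f)

  first-on : ∀ {v b u} → First v b u → v ⟨ b ⟩ u
  first-on {v} {b} {u} f = subst (λ r → b ∈ₗ verts r) (sym (first-route f)) (there (start∈ (route b u)))

  first-tail : ∀ {v b u z} → First v b u → v ⟨ z ⟩ u → z ≡ v ⊎ b ⟨ z ⟩ u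
  first-tail f z∈ with subst (λ r → _ ∈ₗ verts r) (first-route f) z∈
  ... | here eq = inj₁ eq
  ... | there m = inj₂ m

  first-arc : ∀ {v b} → T (A v b) → First v b b
  first-arc e = e , λ v∈ → arc-≢ e (on-refl v∈)

  first-walk : ∀ {v b u} → T (A v b) → (w : Walk A b u) → v ∉ₗ verts w → First v b u
  first-walk e w v∉ = e , λ v∈ → v∉ (on-walk v∈ w)

  -- The walk b ⇝ u ⇝ u′ avoids `v`. So if every vertex other than `v` is labelled by the arc
  -- through which `v` reaches it, a route that avoids `v` keeps the label.
  first-trans : ∀ {v b u u′} → First v b u → ¬ u ⟨ v ⟩ u′ → First v b u′
  first-trans (e , v∉) v∉′ = e , λ v∈ → case via v∈ _ of λ where
    (inj₁ p) → v∉ p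
    (inj₂ p) → v∉′ p

  first-trans⁻ : ∀ {v b u u′} → First v b u′ → v ≢ u → ¬ u ⟨ v ⟩ u′ → First v b u
  first-trans⁻ f v≢u v∉ with c , f′ ← first-exists v≢u
    with refl ← first-unique f (first-trans f′ v∉) = f′

  first-arc-inv : ∀ {v b u u′} → T (A u u′) → u ≢ v → u′ ≢ v → First v b u → First v b u′
  first-arc-inv e u≢v u′≢v f = first-trans f λ v∈ → case on-arc e v∈ of λ where
    (inj₁ eq) → u≢v (sym eq)
    (inj₂ eq) → u′≢v (sym eq)

  first-arc-inv⁻ : ∀ {v b u u′} → T (A u u′) → u ≢ v → u′ ≢ v → First v b u′ → First v b u
  first-arc-inv⁻ e u≢v u′≢v f = first-trans⁻ f (u≢v ∘ sym) λ v∈ → case on-arc e v∈ of λ where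
    (inj₁ eq) → u≢v (sym eq)
    (inj₂ eq) → u′≢v (sym eq)

  separates : ∀ {v b c x y} → First v b x → First v c y → b ≢ c → x ⟨ v ⟩ y
  separates f g b≢c = decidable-stable (on? _ _ _) λ v∉ → b≢c (first-unique (first-trans f v∉) g)

  last-exists : ∀ {x y} → x ≢ y → ∃[ p ] T (A p y) × x ⟨ p ⟩ y × ¬ x ⟨ y ⟩ p
  last-exists {x} {y} x≢y with route x y in eq
  ... | stop _ = contradiction refl x≢y
  ... | step _ e w with last-arc e w
  ...   | p , v , e′ , eq′ = p , e′ ,
    subst (p ∈ₗ_) (sym (cong verts eq′)) (∈-⊕ˡ v _ (end∈ v)) ,
    λ y∈ → arc-≢ e′ (sym (proj₂ (proj₂ (⊕-path⁻ v _ (subst IsPath (trans eq eq′) (route-path x y)))) y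
                              (on-walk y∈ v) (there (here refl))))

  One : Fin n → Set
  One v = ∀ {a b} → T (A v a) → T (A v b) → a ≡ b

  Branching : Fin n → Set
  Branching v = ∃[ a ] ∃[ b ] T (A v a) × T (A v b) × a ≢ b

  branching? : ∀ v → Dec (Branching v)
  branching? v = any? λ a → any? λ b → T? (A v a) ×-dec T? (A v b) ×-dec ¬? (a ≟ b)

  not-branching : ∀ {v} → ¬ Branching v → One v
  not-branching ¬br e f = decidable-stable (_ ≟ _) λ a≢b → ¬br (_ , _ , e , f , a≢b)

  other-arc : ∀ {v} → Branching v → ∀ a → ∃[ b ] T (A v b) × b ≢ a
  other-arc (c , d , ec , ed , c≢d) a with c ≟ a
  ... | no c≢a = c , ec , c≢a
  ... | yes refl = d , ed , c≢d ∘ sym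

  -- Used mostly with `P` the vertices of a cycle or route: if these miss a vertex, some arc leaves
  -- them for good, and the out-arcs at its tail give a contradiction.
  exit-route : ∀ {P : Fin n → Set} (P? : ∀ v → Dec (P v)) {x y} → P x → ¬ P y →
               ∃[ u ] ∃[ v ] T (A u v) × P u × x ⟨ u ⟩ y × (∀ {z} → P z → ¬ v ⟨ z ⟩ y)
  exit-route P? {x} {y} px ¬py
    with u , v , e , pu , u∈ , w , av ← exit-arc P? (route x y) (lose on-start px) ¬py
    = u , v , e , pu , u∈ , λ pz z∈ → av (on-walk z∈ w) pz

-- Vertex subsets and underlying undirected walks

module _ {n} {P : Fin n → Set} (P? : ∀ v → Dec (P v)) where

  subsetOf : Subset n
  subsetOf = tabulate (does ∘ P?)

  ∈-subsetOf : ∀ {v} → P v → v ∈ subsetOf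
  ∈-subsetOf {v} p = lookup⇒[]= v _ (trans (lookup∘tabulate (does ∘ P?) v) (dec-true (P? v) p))

  ∈-subsetOf⁻ : ∀ {v} → v ∈ subsetOf → P v
  ∈-subsetOf⁻ {v} v∈ with P? v | trans (sym (lookup∘tabulate (does ∘ P?) v)) ([]=⇒lookup v∈)
  ... | yes p | _ = p

module _ {n} (S : Subset n) (v : Fin n) where

  -∈⁺ : ∀ {x} → x ∈ S → x ≢ v → x ∈ S - v
  -∈⁺ = x∈p∧x≢y⇒x∈p-y

  -∈⁻ : ∀ {x} → x ∈ S - v → x ∈ S
  -∈⁻ = p─q⊆p S _

  -≢ : ∀ {x} → x ∈ S - v → x ≢ v
  -≢ x∈ refl = v∉ S v x∈
    where
    v∉ : ∀ {n} (S : Subset n) v → v ∉ S - v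
    v∉ (_ ∷ S) (suc v) (there v∈) = v∉ S v v∈

module Undirected {n} (A : Digraph n) (S : Subset n) where
  U = underlyingOn A S

  private
    lookup-T : ∀ {x} → x ∈ S → T (lookupᵥ S x)
    lookup-T x∈ = Equivalence.from T-≡ ([]=⇒lookup x∈)

    T-lookup : ∀ {x} → T (lookupᵥ S x) → x ∈ S
    T-lookup t = lookup⇒[]= _ S (Equivalence.to T-≡ t)

  edge : ∀ {x y} → x ∈ S → y ∈ S → T (A x y) ⊎ T (A y x) → T (U x y)
  edge x∈ y∈ a = Equivalence.from T-∧ (lookup-T x∈ , Equivalence.from T-∧ (lookup-T y∈ , Equivalence.from T-∨ a))

  edge⁻ : ∀ {x y} → T (U x y) → x ∈ S × y ∈ S × (T (A x y) ⊎ T (A y x))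
  edge⁻ {x} {y} t with x∈ , t′ ← Equivalence.to (T-∧ {lookupᵥ S x}) t
    with y∈ , a ← Equivalence.to (T-∧ {lookupᵥ S y}) t′
    = T-lookup x∈ , T-lookup y∈ , Equivalence.to T-∨ a

  reverse : ∀ {x y} → Walk U x y → Walk U y x
  reverse (stop x) = stop x
  reverse (step x e w) with x∈ , y∈ , a ← edge⁻ e =
    reverse w ⊕ step _ (edge y∈ x∈ (swap a)) (stop x)

  forward : ∀ {x y} (w : Walk A x y) → (∀ {z} → z ∈ₗ verts w → z ∈ S) → Walk U x y
  forward (stop x) w⊆ = stop x
  forward (step x e w) w⊆ =
    step x (edge (w⊆ (here refl)) (w⊆ (there (start∈ w))) (inj₁ e)) (forward w (w⊆ ∘ there))

  connected-hub : ∀ h → (∀ {x} → x ∈ S → Walk U x h) → ConnectedOn A S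
  connected-hub h toHub x y x∈ y∈ = toHub x∈ ⊕ reverse (toHub y∈)

-- Blocks are directed cycles, cut-vertices are branching vertices

module Blocks {n} (A : Digraph n) (cactus : Cactus A) where
  open Routes A cactus

  -- An arc between two vertices other than `v` preserves the first arc from `v` in both directions,
  -- so the first arc is constant on each component left after deleting `v`.
  first-invariant : ∀ S {v b x y} → v ∉ S → Walk (underlyingOn A S) x y → First v b x → First v b y
  first-invariant S v∉ (stop _) f = f
  first-invariant S {v} v∉ (step x {z} e w) f with x∈ , z∈ , a ← Undirected.edge⁻ A S e =
    first-invariant S v∉ w (case a of λ where
      (inj₁ xz) → first-arc-inv xz (avoid x∈) (avoid z∈) f
      (inj₂ zx) → first-arc-inv⁻ zx (avoid z∈) (avoid x∈) f)
    where
    avoid : ∀ {t} → t ∈ S → t ≢ v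
    avoid t∈ refl = v∉ t∈

  nonsep-first : ∀ {S v b x y} → Nonseparable A S → x ∈ S → y ∈ S → x ≢ v → y ≢ v →
                 First v b x → First v b y
  nonsep-first {S} {v} (_ , conn , conn-) x∈ y∈ x≢v y≢v with v ∈? S
  ... | no v∉  = first-invariant S v∉ (conn _ _ x∈ y∈)
  ... | yes v∈ = first-invariant (S - v) (λ v∈- → -≢ S v v∈- refl)
                   (conn- v v∈ _ _ (-∈⁺ S v x∈ x≢v) (-∈⁺ S v y∈ y≢v))

  -- If v → b is the only arc out of `v`, then all other vertices are reached from `b` by routes
  -- that avoid `v`, and `b` connects them.
  cut⇒branching : ∀ {v} → IsCutVertex A v → Branching v
  cut⇒branching {v} cut = decidable-stable (branching? v) λ ¬br → cut (connected (not-branching ¬br))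
    where
    open Undirected A (⊤ - v)
    connected : One v → ConnectedOn A (⊤ - v)
    connected one x y x∈ y∈
      with b , f ← first-exists (-≢ ⊤ v x∈ ∘ sym) | c , g ← first-exists (-≢ ⊤ v y∈ ∘ sym)
      with refl ← one (proj₁ f) (proj₁ g) = reverse (from f) ⊕ from g
      where
      from : ∀ {b z} → First v b z → Walk (underlyingOn A (⊤ - v)) b z
      from (_ , v∉) = forward (route _ _) λ z∈ → -∈⁺ ⊤ v ∈⊤ λ { refl → v∉ z∈ }

  branching⇒cut : ∀ {v} → Branching v → IsCutVertex A v
  branching⇒cut {v} (a , b , ea , eb , a≢b) conn =
    a≢b (first-unique (first-invariant (⊤ - v) (λ v∈ → -≢ ⊤ v v∈ refl)
      (conn a b (-∈⁺ ⊤ v ∈⊤ (arc-≢ ea ∘ sym)) (-∈⁺ ⊤ v ∈⊤ (arc-≢ eb ∘ sym))) (first-arc ea)) (first-arc eb))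

  abstract
    -- The vertex set of the directed cycle through the arc u → b.
    cyc : Fin n → Fin n → Subset n
    cyc u b = subsetOf λ z → on? b z u

    cyc-∈ : ∀ {u b z} → b ⟨ z ⟩ u → z ∈ cyc u b
    cyc-∈ {u} {b} = ∈-subsetOf λ z → on? b z u

    cyc-∈⁻ : ∀ {u b z} → z ∈ cyc u b → b ⟨ z ⟩ u
    cyc-∈⁻ {u} {b} = ∈-subsetOf⁻ λ z → on? b z u

  -- Without `v` the cycle is a path. The vertices behind `v` reach `u` forwards; those before `v`
  -- go back to `b` and cross u → b against its direction. If `v` is `u`, every vertex goes back to
  -- `b`.
  cyc-nonseparable : ∀ {u b} → T (A u b) → Nonseparable A (cyc u b)
  cyc-nonseparable {u} {b} e = (b , cyc-∈ on-start) ,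
    whole , minus
    where
    whole : ConnectedOn A (cyc u b)
    whole = connected-hub b λ x∈ → reverse (forward (route _ _) λ z∈ → cyc-∈ (on-left (cyc-∈⁻ x∈) z∈))
      where open Undirected A (cyc u b)
    minus : ∀ v → v ∈ cyc u b → ConnectedOn A (cyc u b - v)
    minus v v∈ with v ≟ u
    ... | yes refl = connected-hub b λ x∈ → reverse (forward (route _ _) λ z∈ →
        -∈⁺ C v (cyc-∈ (on-left (cyc-∈⁻ (-∈⁻ C v x∈)) z∈))
          λ { refl → -≢ C v x∈ (sym (meet (cyc-∈⁻ (-∈⁻ C v x∈)) z∈ on-end)) })
      where
      C = cyc u b
      open Undirected A (C - v)
    ... | no v≢u = connected-hub u λ {x} x∈ → toHub x (cyc-∈⁻ (-∈⁻ C v x∈)) (-≢ C v x∈)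
      where
      C = cyc u b
      open Undirected A (C - v)
      toHub : ∀ x → b ⟨ x ⟩ u → x ≢ v → Walk (underlyingOn A (C - v)) x u
      toHub x x∈ x≢v with on? b v x
      ... | yes v∈x = forward (route _ _) λ z∈ → -∈⁺ C v (cyc-∈ (on-right x∈ z∈))
                        λ { refl → x≢v (sym (meet x∈ v∈x z∈)) }
      ... | no v∉x = reverse (forward (route b x) λ z∈ → -∈⁺ C v (cyc-∈ (on-left x∈ z∈))
                        λ { refl → v∉x z∈ })
                     ⊕ step b (edge (-∈⁺ C v (cyc-∈ on-start) λ { refl → v∉x on-start })
                                    (-∈⁺ C v (cyc-∈ on-end) (v≢u ∘ sym)) (inj₂ e)) (stop u)

  -- Suppose `z` in `S` is off the cycle. The route from `b` to `z` leaves the cycle at some `v`,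
  -- and `v` is not `u` because this route avoids `u`. Since `z` and `u` both lie in `S`, the routes
  -- from `v` to them start with the same arc; but the one to `u` stays on the cycle.
  nonsep⊆cyc : ∀ {S u b w} → Nonseparable A S → u ∈ S → w ∈ S → First u b w → S ⊆ cyc u b
  nonsep⊆cyc {S} {u} {b} {w} ns u∈ w∈ f {z} z∈ with z ≟ u
  ... | yes refl = cyc-∈ on-end
  ... | no z≢u = cyc-∈ (decidable-stable (on? b z u) λ z∉ → absurd z∉)
    where
    fz : First u b z
    fz = nonsep-first ns w∈ z∈ (first-≢ f ∘ sym) z≢u f
    absurd : ¬ b ⟨ z ⟩ u → _
    absurd z∉ with v , c , e , v∈ , v∈z , out ← exit-route (λ t → on? b t u) {b} {z} on-start z∉
      with v ≟ u
    ... | yes refl = proj₂ fz v∈z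
    ... | no v≢u with d , g ← first-exists v≢u
      with refl ← first-unique g (nonsep-first ns z∈ u∈ (λ { refl → z∉ v∈ }) (v≢u ∘ sym) (e , out v∈))
      = out (on-right v∈ (first-on g)) on-start

  cyc-block : ∀ {u b} → T (A u b) → IsBlock A (cyc u b)
  cyc-block e = cyc-nonseparable e , λ S′ ns ⊆S′ →
    ⊆-antisym (nonsep⊆cyc ns (⊆S′ (cyc-∈ on-end)) (⊆S′ (cyc-∈ on-start)) (first-arc e)) ⊆S′

  block-shape : ∀ {S u w} → IsBlock A S → u ∈ S → w ∈ S → (f : ∃ λ b → First u b w) → S ≡ cyc u (proj₁ f)
  block-shape (ns , maximal) u∈ w∈ (b , f) =
    sym (maximal _ (cyc-nonseparable (proj₁ f)) (nonsep⊆cyc ns u∈ w∈ f))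

  -- The first arc of the route from `u` to `w` determines the block as its cycle.
  blocks-share : ∀ {S S′ u w} → IsBlock A S → IsBlock A S′ → u ≢ w →
                 u ∈ S → w ∈ S → u ∈ S′ → w ∈ S′ → S ≡ S′
  blocks-share bl bl′ u≢w u∈ w∈ u∈′ w∈′ with f ← first-exists u≢w =
    trans (block-shape bl u∈ w∈ f) (sym (block-shape bl′ u∈′ w∈′ f))

  cyc-injective : ∀ {u b c} → T (A u b) → T (A u c) → cyc u b ≡ cyc u c → b ≡ c
  cyc-injective {u} {b} {c} eb ec eq = first-unique
    (first-arc eb) (nonsep-first (cyc-nonseparable ec) (cyc-∈ on-start) (subst (b ∈_) eq (cyc-∈ on-start))
      (arc-≢ ec ∘ sym) (arc-≢ eb ∘ sym) (first-arc ec))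

  module _ {S₁ S₂} (bl₁ : IsBlock A S₁) (bl₂ : IsBlock A S₂) (S₁≢S₂ : S₁ ≢ S₂) where

    other-vertex : ∀ u → ∃[ v ] u ≢ v
    other-vertex u with any? (λ v → ¬? (u ≟ v))
    ... | yes found = found
    ... | no none = contradiction
      (⊆-antisym (λ {x} _ → all∈ bl₂ x) (λ {x} _ → all∈ bl₁ x)) S₁≢S₂
      where
      u≡ : ∀ v → u ≡ v
      u≡ v = decidable-stable (u ≟ v) λ u≢v → none (v , u≢v)
      all∈ : ∀ {S} → IsBlock A S → ∀ x → x ∈ S
      all∈ {S} (((y , y∈) , _) , _) x = subst (_∈ S) (trans (sym (u≡ y)) (u≡ x)) y∈

    -- Two vertices of `S` give the arc. If `u` is the only vertex of `S`, a second vertex of the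
    -- graph still yields an arc out of `u`, and by maximality `S` is the cycle through it.
    block-cyc : ∀ {S} → IsBlock A S → ∃[ u ] ∃[ b ] T (A u b) × S ≡ cyc u b
    block-cyc {S} bl@(ns@((u , u∈) , _) , maximal) with any? (λ w → (w ∈? S) ×-dec ¬? (u ≟ w))
    ... | yes (w , w∈ , u≢w) with f ← first-exists u≢w = u , proj₁ f , proj₁ (proj₂ f) , block-shape bl u∈ w∈ f
    ... | no none with b , e , _ ← first-exists (proj₂ (other-vertex u)) =
      u , b , e , sym (maximal _ (cyc-nonseparable e) λ {w} w∈ →
        subst (_∈ cyc u b) (decidable-stable (u ≟ w) λ u≢w → none (w , w∈ , u≢w)) (cyc-∈ on-end))

    -- If no vertex branches, no route leaves the cycle `S₁`, which then contains every vertex and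
    -- in particular `S₂`, against the maximality of `S₂`.
    branching-exists : ∃ Branching
    branching-exists with any? branching?
    ... | yes found = found
    ... | no none with u , b , e , refl ← block-cyc bl₁ = contradiction
      (proj₂ bl₂ _ (proj₁ bl₁) λ {y} _ → cyc-∈ (decidable-stable (on? b y u) (escape y))) S₁≢S₂
      where
      escape : ∀ y → ¬ ¬ b ⟨ y ⟩ u
      escape y y∉ with v , c , e′ , v∈ , _ , out ← exit-route (λ t → on? b t u) {b} {y} on-start y∉
        with v ≟ u
      ... | yes refl = out on-start (subst (c ⟨_⟩ y) (not-branching (λ br → none (v , br)) e′ e) on-start)
      ... | no v≢u with d , g ← first-exists v≢u =
        out (on-right v∈ (first-on g))
          (subst (c ⟨_⟩ y) (not-branching (λ br → none (v , br)) e′ (proj₁ g)) on-start)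

-- Leaves and dead ends

module Leaves {n} (A : Digraph n) (cactus : Cactus A) where
  open Routes A cactus

  record Leaf : Set where
    field
      k s p     : Fin n
      k→s       : T (A k s)
      p→k       : T (A p k)
      p-on      : s ⟨ p ⟩ k
      k-off     : ¬ s ⟨ k ⟩ p
      single    : ∀ {w} → s ⟨ w ⟩ k → w ≢ k → One w
      branching : Branching k

    -- These are the vertices of the leaf cycle other than `k`; `inside-on` supplies the inclusion
    -- that uses `single`.
    Inside : Fin n → Set
    Inside = First k s

    s-inside : Inside s
    s-inside = first-arc k→s

    p-inside : Inside p
    p-inside = k→s , k-off

    s≢k : s ≢ k
    s≢k = arc-≢ k→s ∘ sym

    p≢k : p ≢ k
    p≢k = arc-≢ p→k

    s≢p : s ≢ p
    s≢p eq = no-digon k→s (subst (λ v → T (A v k)) (sym eq) p→k)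

    -- A route from `s` that avoids `k` could leave the cycle only at a vertex whose single out-arc
    -- stays on the cycle.
    inside-on : ∀ {u} → Inside u → s ⟨ u ⟩ k
    inside-on {u} f = decidable-stable (on? s u k) λ u∉ → absurd u∉
      where
      absurd : ¬ s ⟨ u ⟩ k → ⊥
      absurd u∉ with v , c , e , v∈ , v∈u , out ← exit-route (λ t → on? s t k) {s} {u} on-start u∉
        with v ≟ k
      ... | yes refl = proj₂ f v∈u
      ... | no v≢k with d , g ← first-exists v≢k with refl ← single v∈ v≢k e (proj₁ g) =
        out (on-right v∈ (first-on g)) on-start

    -- Another tail `z` would lie on the cycle with z → s as its only out-arc, so the route from `s`
    -- to `k` would return to `s` after `z`.
    only-k→s : ∀ {z} → T (A z s) → z ≡ k
    only-k→s {z} e = decidable-stable (z ≟ k) λ z≢k →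
      let z-on  = inside-on (first-arc-inv⁻ e z≢k s≢k s-inside)
          b , g = first-exists z≢k
      in proj₂ (subst (λ t → First z t k) (single z-on z≢k (proj₁ g) e) g) z-on

    enters : ∀ {x y} → x ⟨ s ⟩ y → s ≢ x → Inside y
    enters s∈ s≢x with z , e , z∈ , _ ← last-exists (s≢x ∘ sym) with refl ← only-k→s e =
      k→s , λ k∈ → s≢k (sym (meet s∈ z∈ k∈))

    -- The only out-arc of `p` leads to `k`. So `k` comes after `p` on the route and cannot also
    -- come before it, which forces `x` into the leaf.
    leaves : ∀ {x y} → x ⟨ p ⟩ y → p ≢ y → Inside x × p ⟨ k ⟩ y
    leaves p∈ p≢y with c , g ← first-exists p≢y with refl ← single p-on p≢k (proj₁ g) p→k =
      first-trans⁻ p-inside (λ { refl → k-off′ on-start }) k-off′ , first-on g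
      where
      k-off′ : ¬ _ ⟨ k ⟩ p
      k-off′ k∈ = p≢k (sym (meet p∈ k∈ (first-on g)))

  first-prefix : ∀ {v b u g} → First v b u → v ⟨ g ⟩ u → g ≢ v → First v b g
  first-prefix f@(e , v∉) g∈ g≢v with first-tail f g∈
  ... | inj₁ g≡v = contradiction g≡v g≢v
  ... | inj₂ g∈′ = e , λ v∈ → v∉ (on-left g∈′ v∈)

  first-cycle : ∀ {g s v} → T (A g s) → s ⟨ v ⟩ g → v ≢ g → First g s v
  first-cycle e v∈ v≢g = e , λ g∈ → v≢g (sym (meet v∈ g∈ on-end))

  -- The route from `v` to `u` avoids `g`, which `v` reaches through `b₀`. Hence `g` reaches `u`
  -- through the same arc as `v`.
  branch-nested : ∀ {g s v b b₀ u} → First g s v → First v b₀ g → b ≢ b₀ → First v b u → First g s u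
  branch-nested fv g₀ b≢b₀ f = first-trans fv λ g∈ →
    b≢b₀ (first-unique (first-prefix f g∈ (first-≢ fv)) g₀)

  -- If another vertex `v` of the cycle through g → s branches, the search continues along an arc of
  -- `v` that leaves this cycle. The set of vertices beyond that arc is strictly smaller, since it
  -- has lost `v`.
  leafIn : ∀ {g s} → T (A g s) → Branching g → Acc _⊂_ (subsetOf (first? g s)) →
           Σ Leaf λ L → ∀ {u} → Leaf.Inside L u → First g s u
  leafIn {g} {s} e br (acc rec) with any? (λ v → on? s v g ×-dec ¬? (v ≟ g) ×-dec branching? v)
  ... | no none with p , p→g , p∈ , g∉ ← last-exists (arc-≢ e ∘ sym) = record
        { k = g ; s = s ; p = p ; k→s = e ; p→k = p→g ; p-on = p∈ ; k-off = g∉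
        ; single = λ w∈ w≢g → not-branching λ brw → none (_ , w∈ , w≢g , brw)
        ; branching = br } , λ f → f
  ... | yes (v , v∈ , v≢g , brv) with b₀ , g₀ ← first-exists v≢g
    with b , e′ , b≢b₀ ← other-arc brv b₀
    with L , L⊆ ← leafIn e′ brv (rec
           ((λ u∈ → ∈-subsetOf (first? g s) (branch-nested (first-cycle e v∈ v≢g) g₀ b≢b₀ (∈-subsetOf⁻ (first? v b) u∈))) ,
            v , ∈-subsetOf (first? g s) (first-cycle e v∈ v≢g) , λ v∈′ → first-≢ (∈-subsetOf⁻ (first? v b) v∈′) refl))
    = L , branch-nested (first-cycle e v∈ v≢g) g₀ b≢b₀ ∘ L⊆

  record TwoLeaves : Set where
    field
      left right : Leaf
      disjoint   : ∀ {u} → Leaf.Inside left u → Leaf.Inside right u → ⊥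

  two-leaves : ∃ Branching → TwoLeaves
  two-leaves (g , br@(a , b , ea , eb , a≢b))
    with L , L⊆ ← leafIn ea br (⊂-wellFounded _) | R , R⊆ ← leafIn eb br (⊂-wellFounded _)
    = record { left = L ; right = R ; disjoint = λ l r → a≢b (first-unique (L⊆ l) (R⊆ r)) }

  swap-leaves : TwoLeaves → TwoLeaves
  swap-leaves t = record { left = right ; right = left ; disjoint = λ r l → disjoint l r }
    where open TwoLeaves t

  -- The routes from `s` form an out-tree, and `a` is one of its ends.
  Dead : Fin n → Fin n → Set
  Dead s a = ∀ y → s ⟨ a ⟩ y → a ≡ y

  dead-beyond : ∀ s v → ∃[ a ] Dead s a × s ⟨ v ⟩ a
  dead-beyond s v = go v on-end (⊂-wellFounded _)
    where
    go : ∀ a → s ⟨ v ⟩ a → Acc _⊂_ (subsetOf (λ u → on? s a u)) → ∃[ b ] Dead s b × s ⟨ v ⟩ b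
    go a v∈ (acc rec) with any? (λ y → on? s a y ×-dec ¬? (a ≟ y))
    ... | no none = a , (λ y a∈ → decidable-stable (a ≟ y) λ a≢y → none (y , a∈ , a≢y)) , v∈
    ... | yes (y , a∈ , a≢y) = go y (on-left a∈ v∈)
      (rec ((λ u∈ → ∈-subsetOf (λ u → on? s a u) (on-left (∈-subsetOf⁻ (λ u → on? s y u) u∈) a∈)) ,
            a , ∈-subsetOf (λ u → on? s a u) on-end , λ a∈′ → a≢y (sym (meet a∈ (∈-subsetOf⁻ (λ u → on? s y u) a∈′) on-end))))

  module DeadEnds (L : Leaf) where
    open Leaf L

    dead-≢ : ∀ {a y} → Dead s a → s ⟨ y ⟩ k → y ≢ k → a ≢ y
    dead-≢ dead y∈ y≢k refl = y≢k (dead _ y∈)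

    k-not-dead : ¬ Dead s k
    k-not-dead dead with b , e , b≢s ← other-arc branching s =
      arc-≢ e (dead _ (separates s-inside (first-arc e) (b≢s ∘ sym)))

    -- The route is x ⇝ k ⇝ y with `x` in the leaf. On x ⇝ k, a part of s ⇝ k, the end `a` could
    -- only be `k`, which is not dead. On k ⇝ y it also lies on the route from `s` to `y`: either
    -- that route passes `k`, or `y` is in the leaf and k ⇝ y goes through `s`.
    dead-end : ∀ {a x y} → Dead s a → x ⟨ p ⟩ y → p ≢ y → x ⟨ a ⟩ y → a ≡ y
    dead-end {a} {x} {y} dead p∈ p≢y a∈ with x-in , k∈ ← leaves p∈ p≢y with via a∈ k
    ... | inj₁ a∈xk = contradiction (subst (Dead s) (dead _ (on-right (inside-on x-in) a∈xk)) dead) k-not-dead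
    ... | inj₂ a∈ky with y ≟ k
    ...   | yes refl = on-refl a∈ky
    ...   | no y≢k with b , f ← first-exists (y≢k ∘ sym) with b ≟ s
    ...     | no b≢s = dead _ (on-right (separates s-inside f (b≢s ∘ sym)) a∈ky)
    ...     | yes refl with first-tail f a∈ky
    ...       | inj₁ refl = contradiction dead k-not-dead
    ...       | inj₂ a∈sy = dead _ a∈sy

  module _ (t : TwoLeaves) where
    open TwoLeaves t
    open Leaf left using () renaming (s to sL)
    open Leaf right using () renaming (k to kR; s to sR; p to pR)

    -- The route from `sL` to `pR` enters the right leaf through `kR` and `sR`, so it continues
    -- beyond `sR`.
    dead-≢-other : ∀ {a} → Dead sL a → a ≢ pR → a ≢ sR
    dead-≢-other dead a≢pR refl = a≢pR (dead _ (on-right kR-on (first-on (Leaf.p-inside right))))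
      where
      kR-on : sL ⟨ kR ⟩ pR
      kR-on with kR ≟ sL
      ... | yes eq = subst (sL ⟨_⟩ pR) (sym eq) on-start
      ... | no kR≢sL with b , f ← first-exists kR≢sL =
        separates f (Leaf.p-inside right) λ { refl → disjoint (Leaf.s-inside left) f }

-- Lists without repetition, merging of colours, vertex counts of paths

Unique-map : ∀ {X Y : Set} (f : X → Y) (xs : List X) → Unique xs →
             (∀ {u v} → u ∈ₗ xs → v ∈ₗ xs → f u ≡ f v → u ≡ v) → Unique (map f xs)
Unique-map f []       _        _   = []
Unique-map f (x ∷ xs) (x# ∷ u) inj =
  All.tabulate (λ y∈ eq → let z , z∈ , eq′ = ∈-map⁻ f y∈ in
    All.lookup x# z∈ (inj (here refl) (there z∈) (trans eq eq′)))
  ∷ Unique-map f xs u (λ u∈ v∈ → inj (there u∈) (there v∈))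

lookup-injective : ∀ {X : Set} {xs : List X} → Unique xs → Injective _≡_ _≡_ (lookup xs)
lookup-injective (x# ∷ u) {zero}  {zero}  eq = refl
lookup-injective {xs = x ∷ xs} (x# ∷ u) {zero}  {suc j} eq = contradiction eq (All.lookup x# (∈-lookup j))
lookup-injective {xs = x ∷ xs} (x# ∷ u) {suc i} {zero}  eq = contradiction (sym eq) (All.lookup x# (∈-lookup i))
lookup-injective (x# ∷ u) {suc i} {suc j} eq = cong suc (lookup-injective u eq)

unique-length≤ : ∀ {k} {xs : List (Fin k)} → Unique xs → length xs ≤ k
unique-length≤ u = injective⇒≤ (lookup-injective u)

covering-length≥ : ∀ {n} {xs : List (Fin n)} → (∀ v → v ∈ₗ xs) → n ≤ length xs
covering-length≥ {xs = xs} cover = injective⇒≤ {f = λ v → index (cover v)} λ {u} {v} eq →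
  trans (lookup-index (cover u)) (trans (cong (lookup xs) eq) (sym (lookup-index (cover v))))

-- Each `punchOut` removes one value that `r` never takes. Being injective, it merges no other
-- values and leaves the remaining `e i` distinct and untaken.
factor : ∀ j {n m} (r : Fin n → Fin m) (e : Fin j → Fin m) → Injective _≡_ _≡_ e → (∀ u i → r u ≢ e i) →
         Σ (Fin n → Fin (m ∸ j)) λ c → ∀ u v → c u ≡ c v → r u ≡ r v
factor zero r e _ _ = r , λ _ _ eq → eq
factor (suc j) {m = zero} r e _ _ with () ← e zero
factor (suc j) {m = suc m} r e e-inj avoid
  with c , c-inj ← factor j (λ u → punchOut (avoid u zero ∘ sym))
                     (λ i → punchOut {j = e (suc i)} λ eq → case e-inj eq of λ ())
                     (λ {i} {i′} eq → suc-injective (e-inj (punchOut-injective {i = e zero} _ _ eq)))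
                     (λ u i eq → avoid u (suc i) (punchOut-injective {i = e zero} _ _ eq))
  = c , λ u v eq → punchOut-injective {i = e zero} _ _ (c-inj u v eq)

-- Giving each of the distinct elements e i the colour of t i saves j colours.
collapse : ∀ j {n} (e t : Fin j → Fin n) → Injective _≡_ _≡_ e → (∀ i i′ → t i ≢ e i′) →
           (R : Fin n → Fin n → Set) → (∀ {u v} → R u v → R v u) → (∀ i → R (e i) (t i)) →
           (∀ i i′ → i ≢ i′ → t i ≡ t i′ → R (e i) (e i′)) →
           Σ (Fin n → Fin (n ∸ j)) λ c → ∀ u v → c u ≡ c v → u ≡ v ⊎ R u v
collapse j {n} e t e-inj t≢e R R-sym Ret Ree
  = let c , c-inj = factor j r e e-inj avoid in c , λ u v eq → related u v (c-inj u v eq)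
  where
  merged? : ∀ u → Dec (∃[ i ] e i ≡ u)
  merged? u = any? λ i → e i ≟ u
  r : Fin n → Fin n
  r u with merged? u
  ... | yes (i , _) = t i
  ... | no _        = u
  avoid : ∀ u i → r u ≢ e i
  avoid u i with merged? u
  ... | yes (i′ , _) = t≢e i′ i
  ... | no none      = λ eq → none (i , sym eq)
  related : ∀ u v → r u ≡ r v → u ≡ v ⊎ R u v
  related u v eq with merged? u | merged? v
  ... | no _ | no _ = inj₁ eq
  ... | yes (i , refl) | no _ = inj₂ (subst (R u) eq (Ret i))
  ... | no _ | yes (i , refl) = inj₂ (R-sym (subst (R v) (sym eq) (Ret i)))
  ... | yes (i , refl) | yes (i′ , refl) with i ≟ i′
  ...   | yes refl = inj₁ refl
  ...   | no i≢i′  = inj₂ (Ree i i′ i≢i′ eq)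

module _ {n} {A : Digraph n} where

  initVerts-path : ∀ {x y} (w : Walk A x y) → IsPath w →
                   Unique (initVerts w) × (∀ {u} → u ∈ₗ initVerts w → u ∈ₗ verts w × u ≢ y)
  initVerts-path (stop _) _ = [] , λ ()
  initVerts-path {y = y} (step x e w) p
    with x∉ , pw ← step-path⁻ e w p
    with uw , sub ← initVerts-path w pw =
    All.tabulate (λ u∈ x≡u → x∉ (subst (_∈ₗ verts w) (sym x≡u) (proj₁ (sub u∈)))) ∷ uw , λ where
      (here refl) → here refl , λ x≡y → x∉ (subst (_∈ₗ verts w) (sym x≡y) (end∈ w))
      (there u∈)  → there (proj₁ (sub u∈)) , proj₂ (sub u∈)

  internal-path : ∀ {x y} (w : Walk A x y) → IsPath w →
                  Unique (internal w) × (∀ {u} → u ∈ₗ internal w → u ∈ₗ verts w × u ≢ x × u ≢ y)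
  internal-path (stop _) _ = [] , λ ()
  internal-path (step x e w) p
    with x∉ , pw ← step-path⁻ e w p
    with uw , sub ← initVerts-path w pw =
    uw , λ u∈ → there (proj₁ (sub u∈)) , (λ { refl → x∉ (proj₁ (sub u∈)) }) , proj₂ (sub u∈)

  heads : ∀ {x y} (w : Walk A x y) → x ∷ map proj₂ (arcs w) ≡ verts w
  heads (stop _)     = refl
  heads (step x e w) = cong (x ∷_) (heads w)

  heads-path : ∀ {x y} (w : Walk A x y) → IsPath w →
               Unique (map proj₂ (arcs w)) × (∀ {u} → u ∈ₗ map proj₂ (arcs w) → u ∈ₗ verts w × u ≢ x)
  heads-path {x} w p with x# ∷ u ← subst Unique (sym (heads w)) p =
    u , λ u∈ → subst (_ ∈ₗ_) (heads w) (there u∈) , λ { refl → All.lookup x# u∈ refl }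

  length-arcs : ∀ {x y} (w : Walk A x y) → suc (length (arcs w)) ≡ length (verts w)
  length-arcs (stop _)     = refl
  length-arcs (step _ _ w) = cong suc (length-arcs w)

  length-initVerts : ∀ {x y} (w : Walk A x y) → suc (length (initVerts w)) ≡ length (verts w)
  length-initVerts (stop _)     = refl
  length-initVerts (step _ _ w) = cong suc (length-initVerts w)

  length-internal : ∀ {x y} (w : Walk A x y) → x ≢ y → suc (suc (length (internal w))) ≡ length (verts w)
  length-internal (stop _)     x≢x = contradiction refl x≢x
  length-internal (step _ _ w) _   = cong suc (length-initVerts w)

-- Colourings from two leaves

module Colourings {n} (A : Digraph n) (cactus : Cactus A) where
  open Routes A cactus
  open Leaves A cactus

  NeverBothInternal : Fin n → Fin n → Set
  NeverBothInternal u v = ∀ {x y} → x ⟨ u ⟩ y → u ≢ x → u ≢ y → x ⟨ v ⟩ y → v ≢ x → v ≢ y → ⊥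

  NeverBothEntered : Fin n → Fin n → Set
  NeverBothEntered u v = ∀ {x y} → x ⟨ u ⟩ y → u ≢ x → x ⟨ v ⟩ y → v ≢ x → ⊥

  VertexColours : ℕ → Set
  VertexColours k = Σ (Fin n → Fin k) λ c → ∀ u v → c u ≡ c v → u ≡ v ⊎ NeverBothInternal u v

  HeadColours : ℕ → Set
  HeadColours k = Σ (Fin n → Fin k) λ h → ∀ u v → h u ≡ h v → u ≡ v ⊎ NeverBothEntered u v

  unique-internal : ∀ {k} ((c , _) : VertexColours k) x y → Unique (map c (internal (route x y)))
  unique-internal (c , ok) x y with u , sub ← internal-path (route x y) (route-path x y) =
    Unique-map c _ u λ {v} {w} v∈ w∈ eq → case ok v w eq of λ where
      (inj₁ v≡w) → v≡w
      (inj₂ never) → let on-v , v≢x , v≢y = sub v∈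
                         on-w , w≢x , w≢y = sub w∈
                     in ⊥-elim (never on-v v≢x v≢y on-w w≢x w≢y)

  unique-heads : ∀ {k} ((h , _) : HeadColours k) x y → Unique (map h (map proj₂ (arcs (route x y))))
  unique-heads (h , ok) x y with u , sub ← heads-path (route x y) (route-path x y) =
    Unique-map h _ u λ {v} {w} v∈ w∈ eq → case ok v w eq of λ where
      (inj₁ v≡w) → v≡w
      (inj₂ never) → ⊥-elim (never (proj₁ (sub v∈)) (proj₂ (sub v∈)) (proj₁ (sub w∈)) (proj₂ (sub w∈)))

  rv-colouring : ∀ {k} → VertexColours k → RVColouring A k
  rv-colouring vc = proj₁ vc , λ x y _ → route x y , route-path x y , unique-internal vc x y

  -- The arcs take the first `k` colours and the vertices the last `l`, so repetitions can only
  -- occur within one of the two groups.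
  tr-colouring : ∀ {k l} → HeadColours k → VertexColours l → TRColouring A (k + l)
  tr-colouring {k} {l} hc@(h , _) vc@(c , _) = (λ v → k ↑ʳ c v) , (λ _ v → h v ↑ˡ l) , λ x y _ →
    route x y , route-path x y ,
    ++⁺ (subst Unique (sym (map-split (λ v → h v ↑ˡ l) (arcs (route x y))))
           (subst Unique (sym (map-∘ (map proj₂ (arcs (route x y))))) (Unique-map⁺ (↑ˡ-injective l _ _) (unique-heads hc x y))))
        (subst Unique (sym (map-∘ (internal (route x y)))) (Unique-map⁺ (↑ʳ-injective k _ _) (unique-internal vc x y)))
        λ {t} (a∈ , v∈) → disjoint (∈-map⁻ _ a∈) (∈-map⁻ _ v∈)
    where
    map-split : ∀ {Y : Set} (f : Fin n → Y) (as : List (Fin n × Fin n)) →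
                map (λ a → f (proj₂ a)) as ≡ map f (map proj₂ as)
    map-split f as = map-∘ as
    disjoint : ∀ {t} {as : List (Fin n × Fin n)} {vs : List (Fin n)} →
               (∃ λ a → a ∈ₗ as × t ≡ h (proj₂ a) ↑ˡ l) → (∃ λ v → v ∈ₗ vs × t ≡ k ↑ʳ c v) → ⊥
    disjoint (a , _ , refl) (v , _ , eq)
      with () ← trans (sym (splitAt-↑ˡ k (h (proj₂ a)) l)) (trans (cong (splitAt k) eq) (splitAt-↑ʳ k l (c v)))

  module _ (t : TwoLeaves) where
    open TwoLeaves t
    open Leaf left using () renaming (s to sL; p to pL)
    open Leaf right using () renaming (s to sR; p to pR)

    inside-≢ : ∀ {u v} → Leaf.Inside left u → Leaf.Inside right v → u ≢ v
    inside-≢ l r refl = disjoint l r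

    sR-sL-entered : NeverBothEntered sR sL
    sR-sL-entered r∈ r≢ l∈ l≢ = disjoint (Leaf.enters left l∈ l≢) (Leaf.enters right r∈ r≢)

    sR-sL-internal : NeverBothInternal sR sL
    sR-sL-internal r∈ r≢ _ l∈ l≢ _ = sR-sL-entered r∈ r≢ l∈ l≢

    pR-pL-internal : NeverBothInternal pR pL
    pR-pL-internal r∈ _ r≢ l∈ _ l≢ = disjoint (proj₁ (Leaf.leaves left l∈ l≢)) (proj₁ (Leaf.leaves right r∈ r≢))

    dead-pL-internal : ∀ {a} → Dead sL a → NeverBothInternal a pL
    dead-pL-internal dead a∈ _ a≢y l∈ _ l≢ = a≢y (DeadEnds.dead-end left dead l∈ l≢ a∈)

    sL≢sR : sL ≢ sR
    sL≢sR = inside-≢ (Leaf.s-inside left) (Leaf.s-inside right)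

    sL≢pR : sL ≢ pR
    sL≢pR = inside-≢ (Leaf.s-inside left) (Leaf.p-inside right)

    pL≢sR : pL ≢ sR
    pL≢sR = inside-≢ (Leaf.p-inside left) (Leaf.s-inside right)

    pL≢pR : pL ≢ pR
    pL≢pR = inside-≢ (Leaf.p-inside left) (Leaf.p-inside right)

    sL≢pL : sL ≢ pL
    sL≢pL = Leaf.s≢p left

    sR≢pR : sR ≢ pR
    sR≢pR = Leaf.s≢p right

    3≤n : 3 ≤ n
    3≤n = injective⇒≤ (lookup-injective {xs = sL ∷ pL ∷ sR ∷ []}
      ((sL≢pL ∷ sL≢sR ∷ []) ∷ (pL≢sR ∷ []) ∷ [] ∷ []))

    headColours : HeadColours (n ∸ 1)
    headColours = collapse 1 (λ _ → sR) (λ _ → sL) (λ { {zero} {zero} _ → refl }) (λ _ _ → sL≢sR)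
      NeverBothEntered (λ never v∈ v≢ u∈ u≢ → never u∈ u≢ v∈ v≢) (λ _ → sR-sL-entered)
      (λ { zero zero 0≢0 _ → contradiction refl 0≢0 })

    never-sym : ∀ {u v} → NeverBothInternal u v → NeverBothInternal v u
    never-sym never v∈ v≢ v≢′ u∈ u≢ u≢′ = never u∈ u≢ u≢′ v∈ v≢ v≢′

    vertexColours : VertexColours (n ∸ 2)
    vertexColours = collapse 2 (lookup (sR ∷ pR ∷ [])) (lookup (sL ∷ pL ∷ []))
      (lookup-injective ((sR≢pR ∷ []) ∷ [] ∷ []))
      (λ { zero zero → sL≢sR ; zero (suc zero) → sL≢pR ; (suc zero) zero → pL≢sR ; (suc zero) (suc zero) → pL≢pR })
      NeverBothInternal never-sym
      (λ { zero → sR-sL-internal ; (suc zero) → pR-pL-internal })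
      (λ { zero zero 0≢0 _ → contradiction refl 0≢0
         ; zero (suc zero) _ eq → contradiction eq sL≢pL
         ; (suc zero) zero _ eq → contradiction (sym eq) sL≢pL
         ; (suc zero) (suc zero) 1≢1 _ → contradiction refl 1≢1 })

  -- Hamiltonian paths and optimal colourings

  Hamiltonian : Set
  Hamiltonian = ∃[ x ] ∃[ y ] ∀ v → x ⟨ v ⟩ y

  module _ (t : TwoLeaves) where
    open TwoLeaves t
    open Leaf left using () renaming (s to sL; p to pL)
    open Leaf right using () renaming (s to sR; p to pR)

    -- Three pairs are merged: `sR` with `sL`, `a` with `pL`, and `b` with `pR`. The inequalities
    -- keep the three merged vertices distinct and apart from their targets.
    fewer-colours : ∀ {a b} → Dead sL a → a ≢ pR → Dead sR b → b ≢ pL → VertexColours (n ∸ 3)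
    fewer-colours {a} {b} da a≢pR db b≢pL with a ≟ b
    ... | no a≢b = collapse 3 (lookup (sR ∷ a ∷ b ∷ [])) (lookup (sL ∷ pL ∷ pR ∷ []))
      (lookup-injective ((a≢sR ∘ sym ∷ b≢sR ∘ sym ∷ []) ∷ (a≢b ∷ []) ∷ [] ∷ []))
      (λ { zero zero → sL≢sR t ; zero (suc zero) → a≢sL ∘ sym ; zero (suc (suc zero)) → b≢sL ∘ sym
         ; (suc zero) zero → pL≢sR t ; (suc zero) (suc zero) → a≢pL ∘ sym ; (suc zero) (suc (suc zero)) → b≢pL ∘ sym
         ; (suc (suc zero)) zero → sR≢pR t ∘ sym ; (suc (suc zero)) (suc zero) → a≢pR ∘ sym
         ; (suc (suc zero)) (suc (suc zero)) → b≢pR ∘ sym })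
      NeverBothInternal (never-sym t)
      (λ { zero → sR-sL-internal t ; (suc zero) → dead-pL-internal t da ; (suc (suc zero)) → dead-pL-internal t′ db })
      (λ i i′ i≢i′ eq → contradiction (lookup-injective
        {xs = sL ∷ pL ∷ pR ∷ []} ((sL≢pL t ∷ sL≢pR t ∷ []) ∷ (pL≢pR t ∷ []) ∷ [] ∷ []) eq) i≢i′)
      where
      t′ = swap-leaves t
      a≢sL = DeadEnds.dead-≢ left da on-start (Leaf.s≢k left)
      a≢pL = DeadEnds.dead-≢ left da (Leaf.p-on left) (Leaf.p≢k left)
      a≢sR = dead-≢-other t da a≢pR
      b≢sR = DeadEnds.dead-≢ right db on-start (Leaf.s≢k right)
      b≢pR = DeadEnds.dead-≢ right db (Leaf.p-on right) (Leaf.p≢k right)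
      b≢sL = dead-≢-other t′ db b≢pL
    -- The last two pairs now overlap in `a`, so `a`, `pL` and `pR` get one common colour; every two
    -- of them are never both internal.
    ... | yes refl = collapse 3 (lookup (sR ∷ a ∷ pR ∷ [])) (lookup (sL ∷ pL ∷ pL ∷ []))
      (lookup-injective ((a≢sR ∘ sym ∷ sR≢pR t ∷ []) ∷ (a≢pR ∷ []) ∷ [] ∷ []))
      (λ { zero zero → sL≢sR t ; zero (suc zero) → a≢sL ∘ sym ; zero (suc (suc zero)) → sL≢pR t
         ; (suc zero) zero → pL≢sR t ; (suc zero) (suc zero) → b≢pL ∘ sym ; (suc zero) (suc (suc zero)) → pL≢pR t
         ; (suc (suc zero)) zero → pL≢sR t ; (suc (suc zero)) (suc zero) → b≢pL ∘ sym
         ; (suc (suc zero)) (suc (suc zero)) → pL≢pR t })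
      NeverBothInternal (never-sym t)
      (λ { zero → sR-sL-internal t ; (suc zero) → dead-pL-internal t da ; (suc (suc zero)) → pR-pL-internal t })
      (λ { zero zero 0≢0 _ → contradiction refl 0≢0
         ; zero (suc zero) _ eq → contradiction eq (sL≢pL t)
         ; zero (suc (suc zero)) _ eq → contradiction eq (sL≢pL t)
         ; (suc zero) zero _ eq → contradiction (sym eq) (sL≢pL t)
         ; (suc zero) (suc zero) 1≢1 _ → contradiction refl 1≢1
         ; (suc zero) (suc (suc zero)) _ _ → dead-pL-internal t′ db
         ; (suc (suc zero)) zero _ eq → contradiction (sym eq) (sL≢pL t)
         ; (suc (suc zero)) (suc zero) _ _ → never-sym t (dead-pL-internal t′ db)
         ; (suc (suc zero)) (suc (suc zero)) 2≢2 _ → contradiction refl 2≢2 })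
      where
      t′ = swap-leaves t
      a≢sL = DeadEnds.dead-≢ left da on-start (Leaf.s≢k left)
      a≢sR = dead-≢-other t da a≢pR

    dead-off : ∀ {s p v} → ¬ s ⟨ v ⟩ p → ∃[ a ] Dead s a × a ≢ p
    dead-off {s} {p} {v} v∉ with a , dead , v∈ ← dead-beyond s v = a , dead , λ { refl → v∉ v∈ }

    -- A vertex missed by a route between the leaves has a dead end beyond it, and this end differs
    -- from the end of that route. When both routes miss a vertex, `fewer-colours` applies.
    hamiltonian-or-fewer : Hamiltonian ⊎ VertexColours (n ∸ 3)
    hamiltonian-or-fewer with any? (λ v → ¬? (on? sL v pR)) | any? (λ v → ¬? (on? sR v pL))
    ... | no none | _ = inj₁ (sL , pR , λ v → decidable-stable (on? sL v pR) λ v∉ → none (v , v∉))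
    ... | yes _ | no none = inj₁ (sR , pL , λ v → decidable-stable (on? sR v pL) λ v∉ → none (v , v∉))
    ... | yes (_ , v∉) | yes (_ , v∉′)
      with a , da , a≢ ← dead-off v∉ | b , db , b≢ ← dead-off v∉′ = inj₂ (fewer-colours da a≢ db b≢)

    hamiltonian-path : (h : Hamiltonian) → let x , y , _ = h in
                       x ≢ y × (∀ (w : Walk A x y) → IsPath w → n ≤ 2 + length (internal w))
    hamiltonian-path (x , y , cover) = x≢y , λ w p →
      subst (n ≤_) (sym (length-internal w x≢y))
        (covering-length≥ λ v → subst (λ r → v ∈ₗ verts r) (route-unique w p) (cover v))
      where
      x≢y : x ≢ y
      x≢y refl = sL≢pL t (trans (on-refl (cover sL)) (sym (on-refl (cover pL))))

    rv-lower : Hamiltonian → ∀ {k} → RVColouring A k → n ∸ 2 ≤ k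
    rv-lower h@(x , y , _) (c , ok) with x≢y , long ← hamiltonian-path h with w , p , u ← ok x y x≢y =
      ≤-trans (∸-monoˡ-≤ 2 (long w p)) (subst (_≤ _) (length-map c (internal w)) (unique-length≤ u))

    tr-lower : Hamiltonian → ∀ {k} → TRColouring A k → 2 * n ∸ 3 ≤ k
    tr-lower h@(x , y , _) (cv , ca , ok) with x≢y , long ← hamiltonian-path h with w , p , u ← ok x y x≢y =
      ≤-trans (twice (long w p)) (subst (_≤ _) eq (unique-length≤ u))
      where
      -- A path with `i` internal vertices has `suc i` arcs, and all their colours are distinct.
      twice : ∀ {i} → n ≤ 2 + i → 2 * n ∸ 3 ≤ suc i + i
      twice {i} n≤ = ≤-trans (∸-monoˡ-≤ 3 (*-monoʳ-≤ 2 n≤)) (≤-reflexive (lemma i))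
        where
        lemma : ∀ i → 2 * (2 + i) ∸ 3 ≡ suc i + i
        lemma i rewrite +-identityʳ i | +-suc i (suc i) | +-suc i i = refl
      as = map (λ a → ca (proj₁ a) (proj₂ a)) (arcs w)
      eq : length (as ++ map cv (internal w)) ≡ suc (length (internal w)) + length (internal w)
      eq = trans (length-++ as) (cong₂ _+_
        (trans (length-map _ (arcs w)) (cong pred (trans (length-arcs w) (sym (length-internal w x≢y)))))
        (length-map cv (internal w)))

    hamiltonian⇒rvc : Hamiltonian → RVC≡ A (n ∸ 2)
    hamiltonian⇒rvc h = rv-colouring (vertexColours t) , λ k k< c → <⇒≱ k< (rv-lower h c)

    hamiltonian⇒trc : Hamiltonian → TRC≡ A (2 * n ∸ 3)
    hamiltonian⇒trc h = subst (TRColouring A) (count (3≤n t)) (tr-colouring (headColours t) (vertexColours t)) ,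
                        λ k k< c → <⇒≱ k< (tr-lower h c)
      where
      count : ∀ {n} → 3 ≤ n → (n ∸ 1) + (n ∸ 2) ≡ 2 * n ∸ 3
      count {suc (suc (suc m))} (s≤s (s≤s (s≤s _))) rewrite +-identityʳ m | +-suc m (suc (suc m)) | +-suc m (suc m) = refl

    rvc⇒hamiltonian : RVC≡ A (n ∸ 2) → Hamiltonian
    rvc⇒hamiltonian (_ , least) with hamiltonian-or-fewer
    ... | inj₁ h = h
    ... | inj₂ c = contradiction (rv-colouring c) (least _ (fewer (3≤n t)))
      where
      -- For `n ≤ 2` truncation would make both sides zero; two leaves guarantee three vertices.
      fewer : ∀ {n} → 3 ≤ n → n ∸ 3 < n ∸ 2
      fewer (s≤s (s≤s (s≤s _))) = ≤-refl

    trc⇒hamiltonian : TRC≡ A (2 * n ∸ 3) → Hamiltonian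
    trc⇒hamiltonian (_ , least) with hamiltonian-or-fewer
    ... | inj₁ h = h
    ... | inj₂ c = contradiction (tr-colouring (headColours t) c) (least _ (fewer (3≤n t)))
      where
      fewer : ∀ {n} → 3 ≤ n → (n ∸ 1) + (n ∸ 3) < 2 * n ∸ 3
      fewer {suc (suc (suc m))} (s≤s (s≤s (s≤s _))) rewrite +-identityʳ m | +-suc m (suc (suc m)) | +-suc m (suc m) | +-suc m m = ≤-refl

-- From the path structure to a Hamiltonian path

Adjacent : ℕ → ℕ → Set
Adjacent a b = suc a ≡ b ⊎ suc b ≡ a

adjacent-triangle : ∀ {a b c} → Adjacent a b → Adjacent b c → Adjacent a c → ⊥
adjacent-triangle (inj₁ refl) (inj₁ refl) (inj₁ ())
adjacent-triangle (inj₁ refl) (inj₁ refl) (inj₂ ())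
adjacent-triangle (inj₁ refl) (inj₂ refl) (inj₁ ())
adjacent-triangle (inj₁ refl) (inj₂ refl) (inj₂ ())
adjacent-triangle (inj₂ refl) (inj₁ refl) (inj₁ ())
adjacent-triangle (inj₂ refl) (inj₁ refl) (inj₂ ())
adjacent-triangle (inj₂ refl) (inj₂ refl) (inj₁ ())
adjacent-triangle (inj₂ refl) (inj₂ refl) (inj₂ ())

two-neighbours : ∀ {a b c d} → Adjacent a b → Adjacent a c → Adjacent a d → b ≡ c ⊎ b ≡ d ⊎ c ≡ d
two-neighbours (inj₁ refl) (inj₁ refl) _           = inj₁ refl
two-neighbours (inj₁ refl) (inj₂ refl) (inj₁ refl) = inj₂ (inj₁ refl)
two-neighbours (inj₁ refl) (inj₂ refl) (inj₂ refl) = inj₂ (inj₂ refl)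
two-neighbours (inj₂ refl) (inj₁ refl) (inj₁ refl) = inj₂ (inj₂ refl)
two-neighbours (inj₂ refl) (inj₁ refl) (inj₂ refl) = inj₂ (inj₁ refl)
two-neighbours (inj₂ refl) (inj₂ refl) _           = inj₁ refl

module PathToHamiltonian {n} (A : Digraph n) (cactus : Cactus A) where
  open Routes A cactus
  open Blocks A cactus
  open Colourings A cactus using (Hamiltonian)

  module _ {q} (bg : BlockGraphIsPath A q) where
    private
      β = proj₁ bg
      β-inj = proj₁ (proj₁ (proj₂ bg))
      β-block = proj₁ (proj₂ (proj₁ (proj₂ bg)))
      β-all = proj₂ (proj₂ (proj₁ (proj₂ bg)))

    meeting-adjacent : ∀ {i j v} → i ≢ j → v ∈ β i → v ∈ β j → Adjacent (toℕ i) (toℕ j)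
    meeting-adjacent {i} {j} {v} i≢j v∈ v∈′ = Equivalence.to (proj₂ (proj₂ bg) i j i≢j) (v , v∈ , v∈′)

    arc-block : ∀ {u b} → T (A u b) → ∃[ i ] β i ≡ cyc u b
    arc-block e = β-all _ (cyc-block e)

    -- Three arcs out of `u` lie in three blocks that meet in `u`, a triangle in the block graph.
    outdegree≤2 : ∀ {u a b c} → T (A u a) → T (A u b) → T (A u c) → a ≢ b → a ≢ c → b ≢ c → ⊥
    outdegree≤2 {u} {a} {b} {c} ea eb ec a≢b a≢c b≢c =
      adjacent-triangle (adj ea eb a≢b) (adj eb ec b≢c) (adj ea ec a≢c)
      where
      adj : ∀ {a b} (ea : T (A u a)) (eb : T (A u b)) → a ≢ b →
            Adjacent (toℕ (proj₁ (arc-block ea))) (toℕ (proj₁ (arc-block eb)))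
      adj ea eb a≢b with i , eq ← arc-block ea | j , eq′ ← arc-block eb =
        meeting-adjacent (λ { refl → a≢b (cyc-injective ea eb (trans (sym eq) eq′)) })
          (subst (u ∈_) (sym eq) (cyc-∈ on-end)) (subst (u ∈_) (sym eq′) (cyc-∈ on-end))

    other-block : ∀ {i u w} → u ∈ β i → w ∈ β i → u ≢ w → Branching u → ∃[ j ] i ≢ j × u ∈ β j
    other-block {i} {u} u∈ w∈ u≢w br with d , f ← first-exists u≢w
      with b , e , b≢d ← other-arc br d
      with j , eq ← arc-block e =
      j , (λ { refl → b≢d (cyc-injective e (proj₁ f) (trans (sym eq) (block-shape (β-block i) u∈ w∈ (d , f)))) }) ,
      subst (u ∈_) (sym eq) (cyc-∈ on-end)

    -- Each of the three vertices lies in a block other than `S`, which is a neighbour of `S`. A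
    -- path allows two neighbours, so two of these blocks coincide and share two vertices with `S`.
    cutvertices≤2 : ∀ {S u v w} → IsBlock A S → u ∈ S → v ∈ S → w ∈ S → Branching u → Branching v → Branching w →
                    u ≢ v → u ≢ w → v ≢ w → ⊥
    cutvertices≤2 {S} {u} {v} {w} bl u∈ v∈ w∈ bu bv bw u≢v u≢w v≢w
      with i , refl ← β-all S bl
      with j₁ , i≢j₁ , u∈₁ ← other-block u∈ v∈ u≢v bu
         | j₂ , i≢j₂ , v∈₂ ← other-block v∈ u∈ (u≢v ∘ sym) bv
         | j₃ , i≢j₃ , w∈₃ ← other-block w∈ u∈ (u≢w ∘ sym) bw
      with two-neighbours (meeting-adjacent i≢j₁ u∈ u∈₁) (meeting-adjacent i≢j₂ v∈ v∈₂) (meeting-adjacent i≢j₃ w∈ w∈₃)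
    ... | inj₁ eq with refl ← toℕ-injective eq =
      i≢j₁ (β-inj (blocks-share (β-block i) (β-block j₁) u≢v u∈ v∈ u∈₁ v∈₂))
    ... | inj₂ (inj₁ eq) with refl ← toℕ-injective eq =
      i≢j₁ (β-inj (blocks-share (β-block i) (β-block j₁) u≢w u∈ w∈ u∈₁ w∈₃))
    ... | inj₂ (inj₂ eq) with refl ← toℕ-injective eq =
      i≢j₂ (β-inj (blocks-share (β-block i) (β-block j₂) v≢w v∈ w∈ v∈₂ w∈₃))

  module _ {q M} (bg : BlockGraphIsPath A q) (cp : CutVerticesDiPath A (suc M)) where
    private
      c = proj₁ cp
      c-inj = proj₁ (proj₂ cp)
      c-cut = proj₁ (proj₂ (proj₂ cp))
      c-arc = proj₂ (proj₂ (proj₂ cp))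

    c-branching : ∀ i → Branching (c i)
    c-branching i = cut⇒branching (Equivalence.from (c-cut (c i)) (i , refl))

    branching-c : ∀ {v} → Branching v → ∃[ i ] c i ≡ v
    branching-c br = Equivalence.to (c-cut _) (branching⇒cut br)

    last-cut : Fin (suc M)
    last-cut = fromℕ M

    -- The last cut-vertex has an out-arc other than the one that starts its route back to the
    -- previous cut-vertex. If `M` is `0` there is no previous one and any out-arc serves.
    beyond : ∃[ x ] T (A (c last-cut) x) × (∀ i → suc (toℕ i) ≡ M → ¬ First (c last-cut) x (c i))
    beyond = choose (any? λ i → suc (toℕ i) ≟ℕ M)
      where
      choose : Dec (∃[ i ] suc (toℕ i) ≡ M) → _
      choose (no none) with x , _ , e , _ ← c-branching last-cut = x , e , λ i eq _ → none (i , eq)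
      choose (yes (i , eq))
        with b , f ← first-exists {c last-cut} {c i}
               (λ ceq → <⇒≢ (n<1+n (toℕ i)) (trans (cong toℕ (sym (c-inj ceq))) (trans (toℕ-fromℕ M) (sym eq))))
        with x , e , x≢b ← other-arc (c-branching last-cut) b =
        x , e , λ i′ eq′ g → x≢b (first-unique g (subst (λ j → First (c last-cut) b (c j))
                                   (toℕ-injective (ℕ-suc-injective (trans eq (sym eq′)))) f))

    x : Fin n
    x = proj₁ beyond

    last→x : T (A (c last-cut) x)
    last→x = proj₁ (proj₂ beyond)

    -- The path c₀ → … → c_M → x.
    γ : ℕ → Fin n
    γ t with t <? suc M
    ... | yes t< = c (fromℕ< t<)
    ... | no _   = x

    γ-c : ∀ i → γ (toℕ i) ≡ c i
    γ-c i with toℕ i <? suc M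
    ... | yes t< = cong c (fromℕ<-toℕ i t<)
    ... | no t≮  = contradiction (toℕ<n i) t≮

    γ-< : ∀ {t} → t < suc M → ∃[ i ] toℕ i ≡ t × γ t ≡ c i
    γ-< {t} t< = fromℕ< t< , toℕ-fromℕ< t< ,
      trans (cong γ (sym (toℕ-fromℕ< t<))) (γ-c (fromℕ< t<))

    γ-last : γ (suc M) ≡ x
    γ-last with suc M <? suc M
    ... | yes t< = contradiction refl (<⇒≢ t<)
    ... | no _   = refl

    γ-branching : ∀ {t} → t < suc M → Branching (γ t)
    γ-branching t< with i , _ , eq ← γ-< t< = subst Branching (sym eq) (c-branching i)

    γ-arc : ∀ {t} → t < suc M → T (A (γ t) (γ (suc t)))
    γ-arc {t} (s≤s t≤) with m≤n⇒m<n∨m≡n t≤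
    ... | inj₁ t<M with i , eqi , γi ← γ-< (s≤s t≤) | j , eqj , γj ← γ-< {suc t} (s≤s t<M) =
      subst₂ (λ a b → T (A a b)) (sym γi) (sym γj)
        (Equivalence.from (c-arc i j) (trans eqj (cong suc (sym eqi))))
    ... | inj₂ refl = subst₂ (λ a b → T (A a b))
      (sym (trans (cong γ (sym (toℕ-fromℕ M))) (γ-c last-cut))) (sym γ-last) last→x

    x-not-c : ∀ i → c i ≢ x
    x-not-c i eq = <⇒≢ (toℕ<n i) (trans (Equivalence.to (c-arc last-cut i) (subst (λ v → T (A (c last-cut) v)) (sym eq) last→x))
                                       (cong suc (toℕ-fromℕ M)))

    γ-distinct : ∀ {s t} → s < t → t ≤ suc M → γ s ≢ γ t
    γ-distinct {s} {t} s<t t≤ eq with i , eqi , γi ← γ-< (≤-trans s<t t≤) with m≤n⇒m<n∨m≡n t≤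
    ... | inj₂ refl = x-not-c i (trans (sym γi) (trans eq γ-last))
    ... | inj₁ t< with j , eqj , γj ← γ-< t< =
      <⇒≢ s<t (trans (sym eqi) (trans (cong toℕ (c-inj (trans (sym γi) (trans eq γj)))) eqj))

    γ-walk : ∀ s d → s + d ≤ suc M → Σ (Walk A (γ s) (γ (s + d))) λ w →
             ∀ {v} → v ∈ₗ verts w → ∃[ t ] s ≤ t × t ≤ suc M × v ≡ γ t
    γ-walk s zero s≤ rewrite +-identityʳ s =
      stop (γ s) , λ { (here refl) → s , ≤-refl , s≤ , refl }
    γ-walk s (suc d) s≤ rewrite +-suc s d
      with w , w⊆ ← γ-walk (suc s) d s≤ =
      step (γ s) (γ-arc (≤-trans (s≤s (m≤m+n s d)) s≤)) w , λ where
        (here refl) → s , ≤-refl , ≤-trans (m≤m+n s (suc d)) (subst (_≤ suc M) (sym (+-suc s d)) s≤) , refl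
        (there v∈)  → let t , s<t , t≤ , eq = w⊆ v∈ in t , <⇒≤ s<t , t≤ , eq

    γ-first : ∀ {s t} → s < t → t ≤ suc M → First (γ s) (γ (suc s)) (γ t)
    γ-first {s} {t} s<t t≤
      with w , w⊆ ← γ-walk (suc s) (t ∸ suc s) (subst (_≤ suc M) (sym (m+[n∸m]≡n s<t)) t≤) =
      subst (λ t → First (γ s) (γ (suc s)) (γ t)) (m+[n∸m]≡n s<t)
        (first-walk (γ-arc (≤-trans s<t t≤)) w λ v∈ → let r , s<r , r≤ , eq = w⊆ v∈ in γ-distinct s<r r≤ eq)

    -- From `γ (suc t)` the route to `x` starts with the arc to `γ (suc (suc t))`. If the route to
    -- `γ t` did too, one block would contain the three cut-vertices `γ t`, `γ (suc t)` and
    -- `γ (suc (suc t))`, or, at the end of the path, the choice of `x` would be violated. So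
    -- `γ (suc t)` separates `x` from `γ t`.
    γ-backwards : ∀ {t} → t < suc M → x ⟨ γ (suc t) ⟩ γ t
    γ-backwards {t} (s≤s t≤) with m≤n⇒m<n∨m≡n t≤
    ... | inj₂ refl = subst (x ⟨_⟩ γ M) (sym γ-last) on-start
    ... | inj₁ t<M
      with b , f ← first-exists (γ-distinct (n<1+n t) (s≤s t≤) ∘ sym) =
      separates (subst (First _ _) γ-last (γ-first (s≤s t<M) ≤-refl)) f λ { refl → not-same f }
      where
      not-same : ¬ First (γ (suc t)) (γ (suc (suc t))) (γ t)
      not-same f with m≤n⇒m<n∨m≡n t<M
      ... | inj₁ 1+t<M = cutvertices≤2 bg (cyc-block (γ-arc (s≤s t≤)))
        (cyc-∈ on-end) (cyc-∈ on-start) (cyc-∈ (first-on f))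
        (γ-branching (s≤s t≤)) (γ-branching (s≤s t<M)) (γ-branching (s≤s 1+t<M))
        (γ-distinct (n<1+n t) (s≤s t≤)) (γ-distinct (s≤s (n≤1+n t)) (s≤s t<M)) (γ-distinct (n<1+n _) (s≤s t<M))
      ... | inj₂ refl with i , eqi , γi ← γ-< (s≤s t≤) =
        proj₂ (proj₂ beyond) i (cong suc eqi)
          (subst₂ (λ a b → First a b (c i)) (trans (cong γ (sym (toℕ-fromℕ M))) (γ-c last-cut)) γ-last
            (subst (First _ _) γi f))

    -- The route x ⇝ y is closed under out-arcs: a cut-vertex cᵢ has only two of them, the route leaves
    -- along one, and the other leads to cᵢ₊₁ (to x if cᵢ is the last cut-vertex), already passed.
    hamiltonian : Hamiltonian
    hamiltonian with e , c₀→e , e≢γ₁ ← other-arc (γ-branching {0} z<s) (γ 1)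
      -- `y` is the predecessor of c₀ on the cycle through the out-arc of c₀ that does not lead to
      -- `γ 1`.
      with y , y→c₀ , _ , c₀-off ← last-exists (arc-≢ c₀→e ∘ sym) =
      x , y , λ v → decidable-stable (on? x v y) λ v∉ →
        let u , w , u→w , u∈ , _ , out = exit-route (λ t → on? x t y) {x} {v} on-start v∉
        in out (closed u∈ u→w) on-start
      where
      y-branch : First (γ 0) e y
      y-branch = c₀→e , c₀-off
      -- Every later cut-vertex is reached from c₀ through `γ 1`, but `y` through `e`.
      y-not-branching : ¬ Branching y
      y-not-branching br with branching-c br
      ... | i , refl with toℕ i in eq
      ...   | zero = arc-≢ y→c₀ (trans (sym (γ-c i)) (cong γ eq))
      ...   | suc t = e≢γ₁ (first-unique y-branch
                (subst (First (γ 0) (γ 1)) (trans (cong γ (sym eq)) (γ-c i)) (γ-first z<s (subst (_≤ suc M) eq (<⇒≤ (toℕ<n i))))))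
      c₀-on : x ⟨ γ 0 ⟩ y
      c₀-on = separates (subst (First (γ 0) (γ 1)) γ-last (γ-first z<s ≤-refl)) y-branch (e≢γ₁ ∘ sym)
      closed : ∀ {u w} → x ⟨ u ⟩ y → T (A u w) → x ⟨ w ⟩ y
      closed {u} {w} u∈ u→w with u ≟ y
      ... | yes refl = subst (x ⟨_⟩ y) (not-branching y-not-branching y→c₀ u→w) c₀-on
      ... | no u≢y with d , f ← first-exists u≢y with w ≟ d
      ...   | yes refl = on-right u∈ (first-on f)
      ...   | no w≢d with i , refl ← branching-c (w , d , u→w , proj₁ f , w≢d)
        with w ≟ γ (suc (toℕ i))
      ...     | yes refl = on-left u∈ (subst (x ⟨ γ (suc (toℕ i)) ⟩_) (γ-c i) (γ-backwards (toℕ<n i)))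
      ...     | no w≢g = ⊥-elim (outdegree≤2 bg u→w (proj₁ f) (subst (λ v → T (A v (γ (suc (toℕ i))))) (γ-c i) (γ-arc (toℕ<n i)))
        w≢d w≢g λ { refl → arc-≢ (proj₁ f)
          (sym (meet u∈ (subst (x ⟨ γ (suc (toℕ i)) ⟩_) (γ-c i) (γ-backwards (toℕ<n i))) (first-on f))) })

-- From a Hamiltonian path to the path structure

crossing : ∀ (g : ℕ → ℕ) {x} m → g 0 ≤ x → x < g m → ∃[ t ] t < m × g t ≤ x × x < g (suc t)
crossing g zero g₀≤ <g = contradiction g₀≤ (<⇒≱ <g)
crossing g {x} (suc m) g₀≤ <g with x <? g m
... | no ≮g = m , ≤-refl , ≮⇒≥ ≮g , <g
... | yes <g′ with t , t< , rest ← crossing g m g₀≤ <g′ = t , ≤-trans t< (n≤1+n m) , rest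

module HamiltonianToPath {n} (A : Digraph n) (cactus : Cactus A) where
  open Routes A cactus
  open Blocks A cactus
  open Colourings A cactus using (Hamiltonian)

  module _ {x₀ y₀ : Fin n} (cover : ∀ v → x₀ ⟨ v ⟩ y₀) where

    abstract
      -- Routes from `x₀` are prefixes of the Hamiltonian path, so this numbers its vertices from
      -- `0`.
      pos : Fin n → ℕ
      pos v = length (initVerts (route x₀ v))

      pos-split : ∀ {u v} → x₀ ⟨ u ⟩ v → pos v ≡ pos u + length (initVerts (route u v))
      pos-split {u} {v} u∈ = trans (cong (length ∘ initVerts) (route-split u∈))
        (trans (cong length (initVerts-⊕ (route x₀ u) (route u v))) (length-++ (initVerts (route x₀ u))))

      pos-step : ∀ {u v} (e : T (A u v)) → route x₀ v ≡ route x₀ u ⊕ step u e (stop v) → pos v ≡ suc (pos u)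
      pos-step {u} {v} e eq = trans (cong (length ∘ initVerts) eq)
        (trans (cong length (initVerts-⊕ (route x₀ u) (step u e (stop v))))
          (trans (length-++ (initVerts (route x₀ u))) (+-comm (pos u) 1)))

    pos-mono : ∀ {u v} → x₀ ⟨ u ⟩ v → pos u ≤ pos v
    pos-mono u∈ = subst (_ ≤_) (sym (pos-split u∈)) (m≤m+n _ _)

    pos-strict : ∀ {u v} → x₀ ⟨ u ⟩ v → u ≢ v → pos u < pos v
    pos-strict {u} {v} u∈ u≢v = subst (_ <_) (sym (pos-split u∈)) (m<m+n _ (nonempty (route u v) u≢v))
      where
      nonempty : ∀ {x y} (w : Walk A x y) → x ≢ y → 0 < length (initVerts w)
      nonempty (stop _)     x≢x = contradiction refl x≢x
      nonempty (step _ _ _) _   = z<s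

    pos≤end : ∀ v → pos v ≤ pos y₀
    pos≤end v = pos-mono (cover v)

    comparable : ∀ u v → x₀ ⟨ u ⟩ v ⊎ x₀ ⟨ v ⟩ u
    comparable u v with via (cover v) u
    ... | inj₁ v∈ = inj₂ v∈
    ... | inj₂ v∈ = inj₁ (nested (cover u) v∈)

    pos-on : ∀ {u v} → pos u ≤ pos v → x₀ ⟨ u ⟩ v
    pos-on {u} {v} u≤v with comparable u v
    ... | inj₁ u∈ = u∈
    ... | inj₂ v∈ with u ≟ v
    ...   | yes refl = on-end
    ...   | no u≢v   = contradiction u≤v (<⇒≱ (pos-strict v∈ (u≢v ∘ sym)))

    pos-injective : ∀ {u v} → pos u ≡ pos v → u ≡ v
    pos-injective {u} {v} eq = decidable-stable (u ≟ v) λ u≢v →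
      <⇒≢ (pos-strict (pos-on (≤-reflexive eq)) u≢v) eq

    between⁺ : ∀ {u z v} → pos u ≤ pos z → pos z ≤ pos v → u ⟨ z ⟩ v
    between⁺ {u} {z} u≤z z≤v with via (pos-on z≤v) u
    ... | inj₁ z∈ with refl ← pos-injective (≤-antisym u≤z (pos-mono z∈)) = on-start
    ... | inj₂ z∈ = z∈

    between⁻ : ∀ {u z v} → pos u ≤ pos v → u ⟨ z ⟩ v → pos u ≤ pos z × pos z ≤ pos v
    between⁻ u≤v z∈ = pos-mono (nested (pos-on u≤v) z∈) , pos-mono (on-right (pos-on u≤v) z∈)

    -- Unless `v` comes before `u`, the arc extends the route from `x₀` to `u` to a path, which is
    -- then the route to `v`.
    arc-pos : ∀ {u v} → T (A u v) → pos v ≡ suc (pos u) ⊎ pos v < pos u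
    arc-pos {u} {v} e with on? x₀ v u
    ... | yes v∈ = inj₂ (pos-strict v∈ (arc-≢ e ∘ sym))
    ... | no v∉  = inj₁ (pos-step e (route-unique (route x₀ u ⊕ step u e (stop v))
        (⊕-path (route x₀ u) (step u e (stop v)) (route-path x₀ u) (step-path {A = A} e (stop v) (λ { (here eq) → arc-≢ e eq }) ([] ∷ []))
          λ { z z∈ (here eq) → eq ; z z∈ (there (here refl)) → contradiction z∈ v∉ })))

    next : ∀ {u} → u ≢ y₀ → ∃[ v ] T (A u v) × pos v ≡ suc (pos u)
    next {u} u≢y₀ with b , f ← first-exists u≢y₀ with arc-pos (proj₁ f)
    ... | inj₁ eq  = b , proj₁ f , eq
    ... | inj₂ b<u = contradiction (pos-mono (nested (cover u) (first-on f))) (<⇒≱ b<u)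

    Back : Fin n → Fin n → Set
    Back b a = T (A b a) × pos a < pos b

    -- Together with `back-∈⁻` this turns the block of a back arc into an interval of positions.
    back-∈⁺ : ∀ {a b z} → pos a ≤ pos z → pos z ≤ pos b → z ∈ cyc b a
    back-∈⁺ a≤z z≤b = cyc-∈ (between⁺ a≤z z≤b)

    back-∈⁻ : ∀ {a b z} → Back b a → z ∈ cyc b a → pos a ≤ pos z × pos z ≤ pos b
    back-∈⁻ (_ , a<b) z∈ = between⁻ (<⇒≤ a<b) (cyc-∈⁻ z∈)

    not-end : ∀ {v b} → pos v < pos b → v ≢ y₀
    not-end {b = b} v<b refl = <⇒≱ v<b (pos≤end b)

    -- Both intervals contain `v` and its successor `w`. Two blocks with two common vertices are
    -- equal, and so are the ends of the intervals.
    overlapping : ∀ {a b a′ b′} v → Back b a → Back b′ a′ → pos a ≤ pos v → pos v < pos b →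
              pos a′ ≤ pos v → pos v < pos b′ → a ≡ a′ × b ≡ b′
    overlapping {a} {b} {a′} {b′} v back back′ a≤v v<b a′≤v v<b′
      with w , e , w≡ ← next (not-end v<b)
      with same ← blocks-share (cyc-block (proj₁ back)) (cyc-block (proj₁ back′)) (arc-≢ e)
        (back-∈⁺ a≤v (<⇒≤ v<b)) (back-∈⁺ (≤-trans (≤-trans a≤v (n≤1+n _)) (≤-reflexive (sym w≡))) (subst (_≤ pos b) (sym w≡) v<b))
        (back-∈⁺ a′≤v (<⇒≤ v<b′)) (back-∈⁺ (≤-trans (≤-trans a′≤v (n≤1+n _)) (≤-reflexive (sym w≡))) (subst (_≤ pos b′) (sym w≡) v<b′))
      = pos-injective (≤-antisym
          (proj₁ (back-∈⁻ back (subst (a′ ∈_) (sym same) (cyc-∈ on-start))))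
          (proj₁ (back-∈⁻ back′ (subst (a ∈_) same (cyc-∈ on-start))))) ,
        pos-injective (≤-antisym
          (proj₂ (back-∈⁻ back′ (subst (b ∈_) same (cyc-∈ on-end))))
          (proj₂ (back-∈⁻ back (subst (b′ ∈_) (sym same) (cyc-∈ on-end)))))

    -- The route from the successor of `v` back to `v` must at last leave the vertices behind `v`,
    -- and it does so by a back arc.
    back-over : ∀ {v} → v ≢ y₀ → ∃[ a ] ∃[ b ] Back b a × pos a ≤ pos v × pos v < pos b
    back-over {v} v≢y₀ with w , _ , w≡ ← next v≢y₀
      with u , t , e , v<u , _ , out ← exit-route (λ t → pos v <? pos t) {w} {v}
             (≤-reflexive (sym w≡)) (λ v<v → <⇒≢ v<v refl)
      = t , u , (e , ≤-<-trans (t≤v out) v<u) , t≤v out , v<u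
      where
      t≤v : ∀ {t} → (∀ {z} → pos v < pos z → ¬ t ⟨ z ⟩ v) → pos t ≤ pos v
      t≤v {t} out = ≮⇒≥ λ v<t → out v<t on-start

    NotJumped : Fin n → Set
    NotJumped v = ∀ {a b} → Back b a → pos a < pos v → pos v < pos b → ⊥

    -- Back arcs from v₁ to v₀ = v, from v₂ to v₁, …, from v_m = y₀ to v_{m-1}.
    Links : Fin n → Set
    Links v = ∃[ m ] Σ (ℕ → Fin n) λ f → f 0 ≡ v × f m ≡ y₀ × (∀ {t} → t < m → Back (f (suc t)) (f t))

    -- A back arc over the step after `v` must end in `v` itself, as no arc jumps over `v`. Its tail
    -- `b` becomes the next vertex of the chain. The fuel `d` bounds the distance left to `y₀`.
    links : ∀ d v → NotJumped v → pos y₀ ≤ pos v + d → Links v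
    links d v nj y₀≤ with v ≟ y₀
    ... | yes refl = 0 , (λ _ → v) , refl , refl , λ ()
    links zero v nj y₀≤ | no v≢y₀ = contradiction
      (pos-injective (≤-antisym (pos≤end v) (subst (pos y₀ ≤_) (+-identityʳ _) y₀≤))) v≢y₀
    links (suc d) v nj y₀≤ | no v≢y₀ with a , b , back , a≤v , v<b ← back-over v≢y₀ with m≤n⇒m<n∨m≡n a≤v
    ... | inj₁ a<v = ⊥-elim (nj back a<v v<b)
    ... | inj₂ a≡v with refl ← pos-injective a≡v
      with m , f , f₀ , fₘ , link ← links d b
        -- No back arc jumps over `b`: one that ends before `v` would jump over `v`, and any other
        -- overlaps b → v and hence has tail `b`.
        (λ {a′} {b′} back′ a′<b b<b′ → case pos a′ <? pos v of λ where
          (yes a′<v) → nj back′ a′<v (<-trans v<b b<b′)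
          (no a′≮v)  → <⇒≢ b<b′ (cong pos (proj₂ (overlapping a′ back back′ (≮⇒≥ a′≮v) a′<b ≤-refl (proj₂ back′)))))
        (≤-trans y₀≤ (subst (_≤ pos b + d) (sym (+-suc (pos v) d)) (+-monoˡ-≤ d v<b)))
      = suc m , (λ { zero → v ; (suc t) → f t }) , refl , fₘ ,
        λ { {zero} _ → subst (λ w → Back w v) (sym f₀) back ; {suc t} (s≤s t<) → link t< }

    all-links : Links x₀
    -- No vertex precedes `x₀`, so nothing jumps over it.
    all-links = links (pos y₀) x₀ (λ {a} _ a<x₀ _ → <⇒≱ a<x₀ (pos-mono on-start)) (m≤n+m (pos y₀) (pos x₀))

    module _ {m} (f : ℕ → Fin n) (f₀ : f 0 ≡ x₀) (fₘ : f m ≡ y₀) (link : ∀ {t} → t < m → Back (f (suc t)) (f t)) where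

      f-strict : ∀ {s t} → s < t → t ≤ m → pos (f s) < pos (f t)
      f-strict {s} {suc t} (s≤s s≤t) t≤m with m≤n⇒m<n∨m≡n s≤t
      ... | inj₁ s<t  = <-trans (f-strict s<t (<⇒≤ t≤m)) (proj₂ (link t≤m))
      ... | inj₂ refl = proj₂ (link t≤m)

      f-mono : ∀ {s t} → s ≤ t → t ≤ m → pos (f s) ≤ pos (f t)
      f-mono s≤t t≤m with m≤n⇒m<n∨m≡n s≤t
      ... | inj₁ s<t  = <⇒≤ (f-strict s<t t≤m)
      ... | inj₂ refl = ≤-refl

      f-injective : ∀ {s t} → s ≤ m → t ≤ m → f s ≡ f t → s ≡ t
      f-injective {s} {t} s≤m t≤m eq with <-cmp s t
      ... | tri< s<t _ _ = contradiction (cong pos eq) (<⇒≢ (f-strict s<t t≤m))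
      ... | tri≈ _ s≡t _ = s≡t
      ... | tri> _ _ t<s = contradiction (cong pos (sym eq)) (<⇒≢ (f-strict t<s s≤m))

      locate : ∀ {v} → v ≢ y₀ → ∃[ t ] t < m × pos (f t) ≤ pos v × pos v < pos (f (suc t))
      locate {v} v≢y₀ = crossing (pos ∘ f) m (subst (λ w → pos w ≤ pos v) (sym f₀) (pos-mono on-start))
        (subst (λ w → pos v < pos w) (sym fₘ) (pos-strict (cover v) v≢y₀))

      -- Some link spans the step after `a`, and by `overlapping` it is the given arc.
      back-link : ∀ {a b} → Back b a → ∃[ t ] t < m × f t ≡ a × f (suc t) ≡ b
      back-link {a} {b} back =
        let t , t< , ≤a , a< = locate (not-end {a} {b} (proj₂ back))
            eq , eq′ = overlapping {f t} {f (suc t)} {a} {b} a (link t<) back ≤a a< ≤-refl (proj₂ back)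
        in t , t< , eq , eq′

      block : ℕ → Subset n
      block t = cyc (f (suc t)) (f t)

      block-isBlock : ∀ {t} → t < m → IsBlock A (block t)
      block-isBlock t< = cyc-block (proj₁ (link t<))

      block-injective : ∀ {s t} → s < m → t < m → block s ≡ block t → s ≡ t
      block-injective {s} {t} s< t< eq with <-cmp s t
      ... | tri≈ _ s≡t _ = s≡t
      ... | tri< s<t _ _ = contradiction (proj₁ (back-∈⁻ (link t<) (subst (f s ∈_) eq (cyc-∈ on-start))))
                             (<⇒≱ (f-strict s<t (<⇒≤ t<)))
      ... | tri> _ _ t<s = contradiction (proj₁ (back-∈⁻ (link s<) (subst (f t ∈_) (sym eq) (cyc-∈ on-start))))
                             (<⇒≱ (f-strict t<s (<⇒≤ s<)))

      block-complete : ∀ {u b} → T (A u b) → ∃[ t ] t < m × block t ≡ cyc u b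
      block-complete {u} {b} e = case arc-pos e of λ where
        (inj₂ b<u) → let t , t< , eq , eq′ = back-link {b} {u} (e , b<u) in t , t< , cong₂ cyc eq′ eq
        (inj₁ b≡)  → let t , t< , ≤u , u< = locate {u} (not-end {u} {b} (≤-reflexive (sym b≡))) in
          t , t< , blocks-share {block t} {cyc u b} {u} {b} (block-isBlock t<) (cyc-block e) (arc-≢ e)
            (back-∈⁺ ≤u (<⇒≤ u<)) (back-∈⁺ (≤-trans ≤u (≤-trans (n≤1+n _) (≤-reflexive (sym b≡)))) (subst (_≤ pos (f (suc t))) (sym b≡) u<))
            (cyc-∈ on-end) (cyc-∈ on-start)

      -- The blocks are consecutive intervals, so those of non-consecutive links are disjoint.
      meet-adjacent : ∀ {s t v} → s < t → t < m → v ∈ block s → v ∈ block t → suc s ≡ t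
      meet-adjacent {s} {t} {v} s<t t<m v∈ v∈′ with m≤n⇒m<n∨m≡n s<t
      ... | inj₂ eq = eq
      ... | inj₁ 1+s<t = contradiction
        (≤-trans (proj₁ (back-∈⁻ (link t<m) v∈′)) (proj₂ (back-∈⁻ (link (<-trans s<t t<m)) v∈)))
        (<⇒≱ (f-strict 1+s<t (<⇒≤ t<m)))

      module _ (as-cyc : ∀ {S} → IsBlock A S → ∃[ u ] ∃[ b ] T (A u b) × S ≡ cyc u b) where

        enumeration : BlockEnum A m (block ∘ toℕ)
        enumeration = (λ eq → toℕ-injective (block-injective (toℕ<n _) (toℕ<n _) eq)) ,
          (λ i → block-isBlock (toℕ<n i)) , complete
          where
          complete : ∀ S → IsBlock A S → ∃[ i ] block (toℕ i) ≡ S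
          complete S bl with u , b , e , refl ← as-cyc bl with t , t< , eq ← block-complete e =
            fromℕ< t< , trans (cong block (toℕ-fromℕ< t<)) eq

        blockGraphIsPath : BlockGraphIsPath A m
        blockGraphIsPath = block ∘ toℕ , enumeration , λ i j i≢j → mk⇔
          (λ (v , v∈ , v∈′) → case <-cmp (toℕ i) (toℕ j) of λ where
            (tri< i<j _ _) → inj₁ (meet-adjacent i<j (toℕ<n j) v∈ v∈′)
            (tri≈ _ eq _)  → contradiction (toℕ-injective eq) i≢j
            (tri> _ _ j<i) → inj₂ (meet-adjacent j<i (toℕ<n i) v∈′ v∈))
          λ where
            (inj₁ eq) → f (toℕ j) , subst (λ t → f t ∈ block (toℕ i)) eq (cyc-∈ on-end) , cyc-∈ on-start
            (inj₂ eq) → f (toℕ i) , cyc-∈ on-start , subst (λ t → f t ∈ block (toℕ j)) eq (cyc-∈ on-end)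

      f-branching : ∀ {t} → suc t < m → Branching (f (suc t))
      f-branching {t} t< with w , e , w≡ ← next {f (suc t)} (not-end (f-strict t< ≤-refl)) =
        w , f t , e , proj₁ (link (<⇒≤ t<)) , λ { refl → <⇒≱ (proj₂ (link (<⇒≤ t<))) (<⇒≤ (≤-reflexive (sym w≡))) }

      end-back : ∀ {a} → T (A y₀ a) → Back y₀ a
      end-back {a} e with arc-pos e
      ... | inj₁ a≡ = contradiction (pos≤end a) (<⇒≱ (≤-reflexive (sym a≡)))
      ... | inj₂ a< = e , a<

      end-one : One y₀
      end-one {a} {b} ea eb =
        let t , t< , eq , eq₁ = back-link {a} {y₀} (end-back ea)
            s , s< , eq′ , eq₁′ = back-link {b} {y₀} (end-back eb)
        in trans (sym eq) (trans (cong f (ℕ-suc-injective (f-injective t< s< (trans eq₁ (sym eq₁′))))) eq′)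

      -- Only one out-arc can go forward, so one of the two is a back arc and thus a link. Its tail
      -- is not `f m`, because `y₀` has a single out-arc.
      branching-f : ∀ {v} → Branching v → ∃[ t ] suc t < m × f (suc t) ≡ v
      branching-f {v} (a , b , ea , eb , a≢b) = case arc-pos ea of λ where
          (inj₂ a<v) → from (ea , a<v)
          (inj₁ a≡)  → case arc-pos eb of λ where
            (inj₂ b<v) → from (eb , b<v)
            (inj₁ b≡)  → contradiction (pos-injective (trans a≡ (sym b≡))) a≢b
        where
        not-end-v : v ≢ y₀
        not-end-v refl = a≢b (end-one ea eb)
        from : ∀ {a} → Back v a → ∃[ t ] suc t < m × f (suc t) ≡ v
        from {a} back =
          let t , t< , _ , eq = back-link {a} {v} back
          in t , ≤∧≢⇒< t< (λ t≡m → not-end-v (trans (sym eq) (trans (cong f t≡m) fₘ))) , eq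

      -- A back arc is a link. A forward arc advances by one position, so it could only join `f s`
      -- to `f (suc s)`, opposite to a link.
      f-arc : ∀ {s t} → s ≤ m → t ≤ m → T (A (f s) (f t)) → s ≡ suc t
      f-arc {s} {t} s≤m t≤m e with arc-pos e
      ... | inj₂ t<s =
        let r , r< , eq , eq′ = back-link {f t} {f s} (e , t<s)
        in trans (sym (f-injective r< s≤m eq′)) (cong suc (f-injective (<⇒≤ r<) t≤m eq))
      ... | inj₁ t≡ with <-cmp s t
      ...   | tri≈ _ refl _ = contradiction e no-loop
      ...   | tri> _ _ t<s = contradiction (<⇒≤ (≤-reflexive (sym t≡))) (<⇒≱ (f-strict t<s s≤m))
      ...   | tri< s<t _ _ = contradiction (proj₁ (link s<m)) (no-digon (subst (λ v → T (A (f s) v)) t≡1+s e))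
        where
        s<m = ≤-trans s<t t≤m
        t≡1+s : f t ≡ f (suc s)
        t≡1+s = pos-injective (≤-antisym (subst (_≤ _) (sym t≡) (proj₂ (link s<m))) (f-mono s<t t≤m))

    module _ {M} (f : ℕ → Fin n) (f₀ : f 0 ≡ x₀) (fₘ : f (suc M) ≡ y₀) (link : ∀ {t} → t < suc M → Back (f (suc t)) (f t)) where

      -- The links run against the Hamiltonian path, so the directed path of cut-vertices is f M →
      -- ... → f 1; the ends `f 0` and `f (suc M)` are left out.
      reversed : Fin M → ℕ
      reversed i = M ∸ toℕ i

      reversed-≤ : ∀ i → reversed i ≤ suc M
      reversed-≤ i = ≤-trans (m∸n≤m M (toℕ i)) (n≤1+n M)

      reversed-suc : ∀ i j → reversed i ≡ suc (reversed j) → toℕ j ≡ suc (toℕ i)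
      reversed-suc i j eq = sym (∸-cancelˡ-≡ {m = suc M} (s≤s (<⇒≤ (toℕ<n i))) (≤-trans (<⇒≤ (toℕ<n j)) (n≤1+n M))
        (trans eq (sym (+-∸-assoc 1 (<⇒≤ (toℕ<n j))))))

      reversed-suc⁻ : ∀ i j → toℕ j ≡ suc (toℕ i) → reversed i ≡ suc (reversed j)
      reversed-suc⁻ i j eq = trans (cong (suc M ∸_) (sym eq)) (+-∸-assoc 1 (<⇒≤ (toℕ<n j)))

      cutVerticesDiPath : CutVerticesDiPath A M
      cutVerticesDiPath = f ∘ reversed ,
        (λ {i} {j} eq → toℕ-injective (∸-cancelˡ-≡ (<⇒≤ (toℕ<n i)) (<⇒≤ (toℕ<n j))
          (f-injective f f₀ fₘ link (reversed-≤ i) (reversed-≤ j) eq))) ,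
        (λ v → mk⇔ (to v ∘ cut⇒branching) λ { (i , refl) → branching⇒cut (from i (reversed i) refl) }) ,
        λ i j → mk⇔ (λ e → reversed-suc i j (f-arc f f₀ fₘ link (reversed-≤ i) (reversed-≤ j) e))
                    (λ eq → subst (λ t → T (A (f t) (f (reversed j)))) (sym (reversed-suc⁻ i j eq))
                              (proj₁ (link (s≤s (m∸n≤m M (toℕ j))))))
        where
        to : ∀ v → Branching v → ∃[ i ] f (reversed i) ≡ v
        to v br with t , s≤s t< , refl ← branching-f f f₀ fₘ link br =
          fromℕ< i< , cong f (trans (cong (M ∸_) (toℕ-fromℕ< i<)) (m∸[m∸n]≡n t<))
          where
          i< : M ∸ suc t < M
          i< = ∸-monoʳ-< z<s t<
        from : ∀ i t → reversed i ≡ t → Branching (f t)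
        from i zero eq = contradiction (subst (0 <_) eq (m<n⇒0<n∸m (toℕ<n i))) λ ()
        from i (suc t) eq = f-branching f f₀ fₘ link (s≤s (subst (_≤ M) eq (m∸n≤m M (toℕ i))))

  enumerations-agree : ∀ {q r β γ} → BlockEnum A q β → BlockEnum A r γ → q ≤ r
  enumerations-agree {β = β} {γ} (β-inj , β-block , _) (_ , _ , γ-all) =
    injective⇒≤ {f = λ i → proj₁ (γ-all _ (β-block i))} λ {i} {j} eq → β-inj
      (trans (sym (proj₂ (γ-all _ (β-block i)))) (trans (cong γ eq) (proj₂ (γ-all _ (β-block j)))))

  path-structure : ∀ {q} → HasBlocks A q → 2 ≤ q → Hamiltonian → BlockGraphIsPath A q × CutVerticesDiPath A (q ∸ 1)
  path-structure {q} (β , enum@(β-inj , β-block , _)) (s≤s (s≤s _)) (x₀ , y₀ , cover) =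
    assemble (all-links cover)
    where
    as-cyc : ∀ {S} → IsBlock A S → ∃[ u ] ∃[ b ] T (A u b) × S ≡ cyc u b
    as-cyc = block-cyc (β-block zero) (β-block (suc zero)) (λ eq → case β-inj eq of λ ())
    assemble : Links cover x₀ → BlockGraphIsPath A q × CutVerticesDiPath A (q ∸ 1)
    assemble (m , f , f₀ , fₘ , link) = relabel q≡m f f₀ fₘ link
      where
      enum′ = enumeration cover f f₀ fₘ link as-cyc
      q≡m : q ≡ m
      q≡m = ≤-antisym (enumerations-agree enum enum′) (enumerations-agree enum′ enum)
      relabel : ∀ {m} → q ≡ m → (f : ℕ → Fin n) → f 0 ≡ x₀ → f m ≡ y₀ →
                (∀ {t} → t < m → Back cover (f (suc t)) (f t)) →
                BlockGraphIsPath A q × CutVerticesDiPath A (q ∸ 1)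
      relabel refl f f₀ fₘ link =
        blockGraphIsPath cover f f₀ fₘ link as-cyc , cutVerticesDiPath cover f f₀ fₘ link

theorem28 : (n q : ℕ) (Q : Digraph n) → IsCactus n q Q → 2 ≤ q →
    (RVC≡ Q (n ∸ 2) ⇔ TRC≡ Q (2 * n ∸ 3)) ×
    (TRC≡ Q (2 * n ∸ 3) ⇔ (BlockGraphIsPath Q q × CutVerticesDiPath Q (q ∸ 1)))
theorem28 n q Q (cactus , blocks@(β , β-inj , β-block , _)) 2≤q@(s≤s (s≤s _)) =
  mk⇔ (hamiltonian⇒trc leaves ∘ rvc⇒hamiltonian leaves) (hamiltonian⇒rvc leaves ∘ trc⇒hamiltonian leaves) ,
  mk⇔ (path-structure blocks 2≤q ∘ trc⇒hamiltonian leaves)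
      (λ (blockPath , cutPath) → hamiltonian⇒trc leaves (hamiltonian blockPath cutPath))
  where
  open Blocks Q cactus
  open Leaves Q cactus
  open Colourings Q cactus
  open PathToHamiltonian Q cactus
  open HamiltonianToPath Q cactus
  leaves : TwoLeaves
  leaves = two-leaves (branching-exists (β-block zero) (β-block (suc zero)) λ eq → case β-inj eq of λ ())
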